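{- Let $r, c \geq 1$, $n = rc$, and let $P, Q \in \mathrm{SYT}(r \times c)$. Let $S = \mathrm{stack}(P, Q) \in \mathrm{SYT}(2r \times c)$. Then the list $\big(\mathrm{prom}_r(S)(1) - n, \ldots, \mathrm{prom}_r(S)(n) - n\big)$ is the permutation of $\{1,\dots,n\}$ given by $$\big(\mathrm{prom}_r(S)(1) - n, \ldots, \mathrm{prom}_r(S)(n) - n\big) = \mathrm{RS}^{ -1}(Q^\top, P^\top),$$ where $Q^\top, P^\top$ denote the transposes of $Q, P$.
   Context: $\mathrm{SYT}(R \times c)$ is the set of standard Young tableaux (English notation, rows increasing left to right, columns increasing top to bottom, entries $1,\dots,N$ with $N=Rc$) of rectangular shape with $R$ rows and $c$ columns. For $P, Q \in \mathrm{SYT}(r\times c)$ and $n=rc$, $\mathrm{stack}(P,Q) \in \mathrm{SYT}(2r \times c)$ is the tableau whose first $r$ rows are $P$ and whose last $r$ rows are $Q$ with $n$ added to every entry. Gromotion: for a filling $T$ of the $R\times c$ rectangle by distinct integers increasing along rows and columns, with smallest entry $m$, delete the cell containing $m$, then repeatedly move the empty cell by swapping it with the smaller of the entries immediately to its right and immediately below it (or the only one that exists) until the empty cell reaches the bottom-right corner; fill that corner with $m+N$. The result is $\mathrm{g}(T)$. Starting from $T \in \mathrm{SYT}(R\times c)$, the $j$-th application of gromotion (computing $\mathrm{g}^j(T)$ from $\mathrm{g}^{j-1}(T)$), $1 \le j \le N$, deletes the entry $j$; during it exactly one entry slides upward from row $i+1$ into row $i$, for each $1\le i\le R-1$. The $i$-th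 promotion permutation $\mathrm{prom}_i(T)$ ($1 \le i \le R-1$) is the list whose $j$-th term is the entry that slides from row $i+1$ into row $i$ during the $j$-th application of gromotion, reduced modulo $N$ to a residue in $\{1,\dots,N\}$; it is a permutation of $\{1, \dots, N\}$. $\mathrm{RS}$ denotes the Robinson–Schensted correspondence $\mathfrak{S}_n \to \bigsqcup_{\lambda\vdash n}\mathrm{SYT}(\lambda)\times\mathrm{SYT}(\lambda)$, $w \mapsto (\text{insertion tableau}, \text{recording tableau})$ obtained by row-inserting $w(1), w(2), \dots, w(n)$ in order. -}

module Defs where

open import Data.Nat using (ℕ; zero; suc; _+_; _*_; _∸_; _<_; _<ᵇ_; _≡ᵇ_)
open import Data.Nat.DivMod using (_%_)
open import Data.Bool using (Bool; true; false; if_then_else_; _∧_)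
open import Data.Product using (_×_; _,_; proj₁; proj₂)
open import Data.Maybe using (Maybe; just; nothing)
open import Data.List using (List; []; _∷_; [_]; _++_; map; upTo; concatMap; foldr)
open import Data.List.Relation.Binary.Permutation.Propositional using (_↭_)

-- Fillings of an R × c rectangle.  Cells are (i , j) with 0 ≤ i < R
-- (row, top to bottom) and 0 ≤ j < c (column, left to right); values
-- outside the rectangle are irrelevant.

Tab : Set
Tab = ℕ → ℕ → ℕ

oneTo : ℕ → List ℕ
oneTo N = map suc (upTo N)

cells : ℕ → ℕ → List (ℕ × ℕ)
cells R c = concatMap (λ i → map (λ j → (i , j)) (upTo c)) (upTo R)

entries : ℕ → ℕ → Tab → List ℕ
entries R c T = map (λ p → T (proj₁ p) (proj₂ p)) (cells R c)

record IsSYT (R c : ℕ) (T : Tab) : Set where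
  field
    rowInc : ∀ i j → i < R → suc j < c → T i j < T i (suc j)
    colInc : ∀ i j → suc i < R → j < c → T i j < T (suc i) j
    perm   : entries R c T ↭ oneTo (R * c)

stack : ℕ → ℕ → Tab → Tab → Tab
stack r n P Q i j = if i <ᵇ r then P i j else Q (i ∸ r) j + n

transposeRows : ℕ → ℕ → Tab → List (List ℕ)
transposeRows r c T = map (λ j → map (λ i → T i j) (upTo r)) (upTo c)

upd : Tab → ℕ → ℕ → ℕ → Tab
upd T i j v a b = if (a ≡ᵇ i) ∧ (b ≡ᵇ j) then v else T a b

argmin : ℕ → ℕ → Tab → ℕ × ℕ
argmin R c T = go (cells R c)
  where
  go : List (ℕ × ℕ) → ℕ × ℕ
  go [] = (0 , 0)
  go (p ∷ []) = p
  go (p ∷ ps@(_ ∷ _)) =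
    let q = go ps in
    if T (proj₁ p) (proj₂ p) <ᵇ T (proj₁ q) (proj₂ q) then p else q

-- slide the empty cell at (i , j) (with fuel).  Returns the new filling
-- and the list of upward moves (k , v): entry v slides from row k+1 into
-- row k (0-indexed rows).
slide : ℕ → ℕ → ℕ → Tab → ℕ → ℕ → Tab × List (ℕ × ℕ)
slide R c zero T i j = (T , [])
slide R c (suc f) T i j =
  if suc i <ᵇ R
  then (if suc j <ᵇ c
        then (if T (suc i) j <ᵇ T i (suc j) then down else right)
        else down)
  else (if suc j <ᵇ c then right else (T , []))
  where
  down : Tab × List (ℕ × ℕ)
  down = let res = slide R c f (upd T i j (T (suc i) j)) (suc i) j
         in (proj₁ res , (i , T (suc i) j) ∷ proj₂ res)
  right : Tab × List (ℕ × ℕ)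
  right = slide R c f (upd T i j (T i (suc j))) i (suc j)

gro : ℕ → ℕ → Tab → Tab × List (ℕ × ℕ)
gro R c T =
  let p   = argmin R c T
      m   = T (proj₁ p) (proj₂ p)
      res = slide R c (R + c) T (proj₁ p) (proj₂ p)
  in (upd (proj₁ res) (R ∸ 1) (c ∸ 1) (m + R * c) , proj₂ res)

pick : ℕ → List (ℕ × ℕ) → ℕ
pick k [] = 0
pick k ((a , v) ∷ ms) = if a ≡ᵇ k then v else pick k ms

residue : ℕ → ℕ → ℕ
residue zero v = v
residue (suc k) v = suc ((v ∸ 1) % suc k)

-- prom_i(T) for T of shape R × c (i is 1-indexed: moves from row i+1 to row i)
prom : ℕ → ℕ → ℕ → Tab → List ℕ
prom i R c T = go (R * c) T
  where
  go : ℕ → Tab → List ℕ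
  go zero T = []
  go (suc k) T =
    let res = gro R c T in
    residue (R * c) (pick (i ∸ 1) (proj₂ res)) ∷ go k (proj₁ res)

bump : ℕ → List ℕ → List ℕ × Maybe ℕ
bump x [] = ([ x ] , nothing)
bump x (y ∷ ys) =
  if x <ᵇ y then (x ∷ ys , just y)
  else (let res = bump x ys in (y ∷ proj₁ res , proj₂ res))

-- insert x; returns new tableau and the (0-indexed) row where a cell was added
insertP : ℕ → List (List ℕ) → List (List ℕ) × ℕ
insertP x [] = ([ x ] ∷ [] , 0)
insertP x (row ∷ rows) with bump x row
... | (row' , nothing) = (row' ∷ rows , 0)
... | (row' , just y) =
  let res = insertP y rows in (row' ∷ proj₁ res , suc (proj₂ res))

addAt : ℕ → ℕ → List (List ℕ) → List (List ℕ)
addAt v zero [] = [ v ] ∷ []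
addAt v zero (row ∷ rows) = (row ++ [ v ]) ∷ rows
addAt v (suc k) [] = [ v ] ∷ []
addAt v (suc k) (row ∷ rows) = row ∷ addAt v k rows

RSgo : ℕ → List ℕ → List (List ℕ) × List (List ℕ) → List (List ℕ) × List (List ℕ)
RSgo k [] PQ = PQ
RSgo k (x ∷ xs) (P , Q) =
  let res = insertP x P in
  RSgo (suc k) xs (proj₁ res , addAt k (proj₂ res) Q)

RS : List ℕ → List (List ℕ) × List (List ℕ)
RS w = RSgo 1 w ([] , [])

{-# OPTIONS --safe #-}
module Submission where

-- Let the entry i of P lie in row a and column b (counted from 0).  The i-th promotion moves the entry
-- Q a (c − 1 − b) from the lower to the upper half, for the following reasons.  While the entries of P are used
-- up, the entries of Q only move upwards in their columns: the hole enters the Q-part below a corner of the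
-- shape λ of the remaining entries of P and then falls straight down.  By evacuation, λ is the rotated
-- complement of the shape of the entries of P up to i, hence the hole falls in column c − 1 − b.
-- So the entries of row a of Q cross in decreasing order, and inserting the next of them bumps straight down
-- column a of the insertion tableau, where it adds the box (b , a).
--
-- For the evacuation theorem a tableau is recorded by the word of the rows of its entries.  Promotions of the
-- words cut down to the letters < q, for all q together, behave as Gelfand–Tsetlin patterns: appending a letter is
-- column insertion, deleting the first letter undoes a row insertion, and the compatibility of the two is the cube
-- lemma for q and q + 1.  On a suffix of a rectangular word row insertion raises the row of the new box by exactly
-- one at each level, which gives the complement.

open import Defs
open import Data.Bool using (true; false; T)
open import Data.Empty using (⊥; ⊥-elim)
open import Data.List using (List; []; _∷_; [_]; _∷ʳ_; map; upTo; applyUpTo; concatMap; take)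
open import Data.List.Membership.Propositional using (_∈_; find; lose)
open import Data.List.Membership.Propositional.Properties
open import Data.List.Properties
open import Data.List.Relation.Binary.Permutation.Propositional using (_↭_; ↭-refl; ↭-sym; ↭⇒↭ₛ; module PermutationReasoning)
open import Data.List.Relation.Binary.Permutation.Propositional.Properties using (∈-resp-↭; ∷↭∷ʳ; ++⁺; map⁺)
import Data.List.Relation.Binary.Permutation.Setoid.Properties as SetoidPermutation
import Data.List.Relation.Unary.All as All
open import Data.List.Relation.Unary.AllPairs using (_∷_)
open import Data.List.Relation.Unary.Any using (here; there)
open import Data.List.Relation.Unary.Unique.Propositional using (Unique)
import Data.List.Relation.Unary.Unique.Propositional.Properties as Unique
open import Data.Maybe using (just; nothing)
open import Data.Nat
open import Data.Nat.DivMod using (m≤n⇒m%n≡m)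
open import Data.Nat.Properties
open import Data.Product using (_×_; _,_; proj₁; proj₂; ∃; ∃₂)
open import Data.Sum using (_⊎_; inj₁; inj₂)
open import Data.Unit using (tt)
open import Function using (_∘_)
open import Relation.Nullary using (Dec; yes; no; ¬_; contradiction)
open import Relation.Nullary.Decidable using (_×-dec_)
open import Relation.Binary.PropositionalEquality hiding ([_])

-- Level q is what the deletions do to the first q rows of P taken by themselves; level r is P
-- itself. The row in which the hole ends at level r depends on the whole history of slides, and the
-- lower levels serve to make it computable. The entry being deleted, originally in row `y i`, is
-- absent at level `y i`; one level higher its hole ends in row 0; from there on each level decides
-- between the rules `same` and `next`. The decision is forced because the pattern of shapes is
-- known in closed form: after i deletions row k of level q depends only on q - 1 - k. This is the
-- extremal Gelfand-Tsetlin pattern of a lowest weight word, and a suffix of a rectangular ballot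
-- word is such a word. The row rule is evident only where the shapes are empty, at the start of a
-- slide. The cube lemma carries it along the word letter by letter to the end, where it is needed,
-- and on the way it reproduces the column rule, so that the next deletion can start from the same
-- hypotheses.

inc : ℕ → (ℕ → ℕ) → ℕ → ℕ
inc a X k with k ≟ a
... | yes _ = suc (X k)
... | no  _ = X k

inc-same : ∀ a X → inc a X a ≡ suc (X a)
inc-same a X with a ≟ a
... | yes _ = refl
... | no ¬p = contradiction refl ¬p

inc-other : ∀ {a k} X → k ≢ a → inc a X k ≡ X k
inc-other {a} {k} X ne with k ≟ a
... | yes e = contradiction e ne
... | no _ = refl

inc-cong : ∀ a {X Y k} → X k ≡ Y k → inc a X k ≡ inc a Y k
inc-cong a {k = k} e with k ≟ a
... | yes _ = cong suc e
... | no _ = e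

≤-inc : ∀ a X k → X k ≤ inc a X k
≤-inc a X k with k ≟ a
... | yes _ = n≤1+n _
... | no _ = ≤-refl

-- If y t is the row of the entry t + 1, then cnt y t is the shape formed by the entries ≤ t.
cnt : (ℕ → ℕ) → ℕ → ℕ → ℕ
cnt y zero = λ _ → 0
cnt y (suc t) = inc (y t) (cnt y t)

-- Local rules: jeu de taquin within a level, insertion between levels

Decreasing : ℕ → (ℕ → ℕ) → Set
Decreasing q Y = ∀ k → suc k < q → Y (suc k) ≤ Y k

Interlace : ℕ → (ℕ → ℕ) → (ℕ → ℕ) → Set
Interlace q Y X = ∀ k → k < q → Y k ≤ X k × X (suc k) ≤ Y k

-- A square of the growth diagram of jeu de taquin: the hole is at the end of row h of inc h X and meets an entry of
-- row p.  The entry moves up into row h under Swap; if it moves to the left (p = h), no row changes.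
-- Letters ≥ q stand for entries that are absent, and are never moved.
Swap : ℕ → (ℕ → ℕ) → ℕ → ℕ → Set
Swap q X h p = p ≡ suc h × p < q × X h ≡ X p

-- Fomin's local rule: the chain X, `inc h X`, `inc p (inc h X)` is rerouted through `inc p X`,
-- unless the box in row p lies directly below the hole. The indices are the letter and the hole
-- after the step.
data Local (q : ℕ) (X : ℕ → ℕ) (h p : ℕ) : ℕ → ℕ → Set where
  swapped : Swap q X h p → Local q X h p h p
  passed : ¬ Swap q X h p → Local q X h p p h

-- M, Y are shapes at level q and N, X the corresponding shapes at level q + 1.  The letters u, p appended to them
-- are related as in column insertion, the holes m, h as in row insertion.
data ColRule (q : ℕ) (M N : ℕ → ℕ) (u p : ℕ) : Set where
  outside : q < u → p ≡ u → ColRule q M N u p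
  inside : u ≤ q → p ≤ u → (∀ k → p ≤ k → k < u → N (suc k) ≡ M k) → ColRule q M N u p

data RowRule (q : ℕ) (Y X : ℕ → ℕ) (m h : ℕ) : Set where
  outside : q < m → h ≡ m → RowRule q Y X m h
  top : m ≡ q → h ≡ 0 → RowRule q Y X m h
  same : m < q → h ≡ m → X m ≡ Y m → RowRule q Y X m h
  next : m < q → h ≡ suc m → Y m < X m → RowRule q Y X m h

-- Removing the box of the hole can do harm only if u is the row directly below it; there it would
-- need Y u = Y m, which is the case that `Swap` takes away.
decreasing-local : ∀ {q Y m u u′ m′} → Local q Y m u u′ m′ →
  Decreasing q Y → Decreasing q (inc m Y) → Decreasing q (inc u (inc m Y)) →
  Decreasing q (inc u′ Y)
decreasing-local (swapped _) _ d₁ _ = d₁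
decreasing-local {q} {Y} {m} {u} (passed ¬s) d₀ _ d₂ k k<q with suc k ≟ u
... | no _ = ≤-trans (d₀ k k<q) (≤-inc u Y k)
... | yes refl with ≤-trans (d₂ k k<q) (≤-reflexive (inc-other {suc k} {k} (inc m Y) (λ e → 1+n≢n (sym e))))
... | b with ≤-trans (s≤s (≤-inc m Y (suc k))) (≤-trans (≤-reflexive (sym (inc-same (suc k) (inc m Y)))) b)
... | b′ with k ≟ m
... | no _ = ≤-trans b′ (≤-inc (suc k) Y k)
... | yes refl = ≤-trans (≤∧≢⇒< (d₀ k k<q) (λ e → ¬s (refl , k<q , sym e))) (≤-inc (suc k) Y k)

-- The cube lemma for two consecutive levels

module Cube {q : ℕ} {Y X : ℕ → ℕ} {m h u p : ℕ}
  (i₀ : Interlace q Y X) (i₁ : Interlace q (inc m Y) (inc h X))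
  (i₂ : Interlace q (inc u (inc m Y)) (inc p (inc h X))) where

  private
    lo₀ : ∀ {k} → k < q → Y k ≤ X k
    lo₀ k<q = proj₁ (i₀ _ k<q)
    hi₀ : ∀ {k} → k < q → X (suc k) ≤ Y k
    hi₀ k<q = proj₂ (i₀ _ k<q)

  -- The lower bound is in danger only in row u′ when p′ < u′. Then row u′ of X is as long as row u′
  -- - 1 of Y, which exceeds row u′ of Y because `inc u′ Y` is decreasing.
  interlace : ∀ {u′ p′} → Decreasing q (inc u′ Y) → ColRule q Y X u′ p′ →
    (∀ k → p′ ≡ suc k → k < q → X (suc k) < Y k) → Interlace q (inc u′ Y) (inc p′ X)
  interlace {u′} {p′} d cr ub k k<q = lower cr , upper
    where
    strict : ∀ k → k < q → k ≡ u′ → p′ < u′ → (∀ k → p′ ≤ k → k < u′ → X (suc k) ≡ Y k) → Y k < X k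
    strict (suc k) k<q refl (s≤s p≤k) bl = begin
      suc (Y u′) ≡⟨ inc-same u′ Y ⟨
      inc u′ Y u′ ≤⟨ d k k<q ⟩
      inc u′ Y k ≡⟨ inc-other Y (λ e → 1+n≢n (sym e)) ⟩
      Y k ≡⟨ bl k p≤k ≤-refl ⟨
      X u′ ∎
      where open ≤-Reasoning
    lower : ColRule q Y X u′ p′ → inc u′ Y k ≤ inc p′ X k
    lower (outside q<u _) = ≤-trans (≤-reflexive (inc-other Y (<⇒≢ (<-trans k<q q<u)))) (≤-trans (lo₀ k<q) (≤-inc p′ X k))
    lower (inside u≤q p≤u bl) with k ≟ u′ | k ≟ p′
    ... | no _ | no _ = lo₀ k<q
    ... | no _ | yes _ = m≤n⇒m≤1+n (lo₀ k<q)
    ... | yes _ | yes _ = s≤s (lo₀ k<q)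
    ... | yes k≡u | no k≢p = strict k k<q k≡u (≤∧≢⇒< p≤u (λ e → k≢p (trans k≡u (sym e)))) bl
    upper : inc p′ X (suc k) ≤ inc u′ Y k
    upper with suc k ≟ p′
    ... | no _ = ≤-trans (hi₀ k<q) (≤-inc u′ Y k)
    ... | yes refl = ≤-trans (ub k refl k<q) (≤-inc u′ Y k)

  private
    hiN : ∀ k → k < q → h ≢ suc k → p ≡ suc k → u ≢ k → suc (X (suc k)) ≤ inc m Y k
    hiN k k<q h≢ refl u≢ = begin
      suc (X p) ≡⟨ cong suc (inc-other X (λ e → h≢ (sym e))) ⟨
      suc (inc h X p) ≡⟨ inc-same p (inc h X) ⟨
      inc p (inc h X) p ≤⟨ proj₂ (i₂ k k<q) ⟩
      inc u (inc m Y) k ≡⟨ inc-other (inc m Y) (λ e → u≢ (sym e)) ⟩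
      inc m Y k ∎
      where open ≤-Reasoning

    hiN′ : ∀ k → k < q → h ≢ suc k → m ≢ k → p ≡ suc k → u ≢ k → X (suc k) < Y k
    hiN′ k k<q h≢ m≢ pe u≢ =
      ≤-trans (hiN k k<q h≢ pe u≢) (≤-reflexive (inc-other Y (λ e → m≢ (sym e))))

    hiNN : ∀ k → k < q → h ≡ suc k → m ≡ k → p ≡ suc k → u ≢ k → suc (X (suc k)) ≤ Y k
    hiNN k k<q refl refl refl u≢ = s≤s⁻¹ (begin
      suc (suc (X p)) ≡⟨ cong suc (inc-same p X) ⟨
      suc (inc p X p) ≡⟨ inc-same p (inc h X) ⟨
      inc p (inc h X) p ≤⟨ proj₂ (i₂ k k<q) ⟩
      inc u (inc m Y) k ≡⟨ inc-other (inc m Y) (λ e → u≢ (sym e)) ⟩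
      inc m Y k ≡⟨ inc-same m Y ⟩
      suc (Y k) ∎)
      where open ≤-Reasoning

    loM : m < q → u ≡ m → p ≢ m → suc (suc (Y m)) ≤ inc h X m
    loM m<q refl p≢ = begin
      suc (suc (Y m)) ≡⟨ cong suc (inc-same m Y) ⟨
      suc (inc m Y m) ≡⟨ inc-same m (inc m Y) ⟨
      inc m (inc m Y) m ≤⟨ proj₁ (i₂ m m<q) ⟩
      inc p (inc h X) m ≡⟨ inc-other (inc h X) (λ e → p≢ (sym e)) ⟩
      inc h X m ∎
      where open ≤-Reasoning

  InnerCol : Set
  InnerCol = u ≤ q × p ≤ u × (∀ k → p ≤ k → k < u → inc h X (suc k) ≡ inc m Y k)

  data InnerRow : Set where
    top : m ≡ q → h ≡ 0 → InnerRow
    same : m < q → h ≡ m → X m ≡ Y m → InnerRow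
    next : m < q → h ≡ suc m → Y m < X m → InnerRow

  private
    -- Being blocked in row m compares row m + 1 of X with row m of Y including the hole, one box
    -- more than interlacing without the hole permits.
    noDiag : InnerCol → m < q → h ≡ m → p ≤ m → m < u → ⊥
    noDiag (u≤q , p≤u , bl) m<q refl p≤m m<u = <⇒≱ (≤-refl {suc (Y m)}) (begin
      suc (Y m) ≡⟨ inc-same m Y ⟨
      inc m Y m ≡⟨ bl m p≤m m<u ⟨
      inc m X (suc m) ≡⟨ inc-other X 1+n≢n ⟩
      X (suc m) ≤⟨ hi₀ m<q ⟩
      Y m ∎)
      where open ≤-Reasoning

    -- Under `next` the two hole boxes lie in rows m and m + 1, which blocking compares with each
    -- other, so they cancel. Under `same` they would not cancel for k = m or k = m - 1; `noDiag`
    -- and `loM` exclude these rows.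
    blocked : InnerCol → InnerRow → ∀ k → p ≤ k → k < u → X (suc k) ≡ Y k
    blocked (u≤q , p≤u , bl) (top refl refl) k p≤k k<u =
      trans (sym (inc-other {0} {suc k} X λ ())) (trans (bl k p≤k k<u) (inc-other Y (<⇒≢ (<-≤-trans k<u u≤q))))
    blocked mn@(u≤q , p≤u , bl) (same m<q refl e) k p≤k k<u with k ≟ m
    ... | yes refl = ⊥-elim (noDiag mn m<q refl p≤k k<u)
    ... | no k≢m with suc k ≟ m
    ... | no sk≢m = trans (sym (inc-other X sk≢m)) (trans (bl k p≤k k<u) (inc-other Y k≢m))
    ... | yes refl with m≤n⇒m<n∨m≡n k<u
    ... | inj₁ m<u = ⊥-elim (noDiag mn m<q refl (m≤n⇒m≤1+n p≤k) m<u)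
    ... | inj₂ refl = ⊥-elim (<⇒≱ (≤-refl {suc (suc (Y m))}) (≤-trans (loM m<q refl (<⇒≢ (s≤s p≤k))) (≤-reflexive (trans (inc-same m X) (cong suc e)))))
    blocked (u≤q , p≤u , bl) (next m<q refl lt) k p≤k k<u with k ≟ m
    ... | yes refl = suc-injective (trans (sym (inc-same h X)) (trans (bl k p≤k k<u) (inc-same m Y)))
    ... | no k≢m = trans (sym (inc-other X (λ e → k≢m (suc-injective e)))) (trans (bl k p≤k k<u) (inc-other Y k≢m))

  -- `ColRule` says that the rows passed over are blocked; `upper` adds that row p′ itself is free,
  -- which the new interlacing requires.
  record Result (u′ m′ p′ h′ : ℕ) : Set where
    constructor result
    field
      col : ColRule q Y X u′ p′
      row : RowRule q (inc u′ Y) (inc p′ X) m′ h′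
      upper : ∀ k → p′ ≡ suc k → k < q → X (suc k) < Y k

  private
    ≢-below : ∀ {k} → p ≡ suc k → p ≤ u → u ≢ k
    ≢-below refl p≤u refl = 1+n≰n p≤u

    -- No swap can happen: for p = 1 there is room below row 0 of Y, hence X 1 < Y 0 ≤ X 0, whereas
    -- a swap needs X 0 = X 1.
    cube-top : InnerCol → m ≡ q → h ≡ 0 → ∀ {u′ m′ p′ h′} → Local q Y m u u′ m′ → Local (suc q) X h p p′ h′ →
      Result u′ m′ p′ h′
    cube-top mn refl refl (swapped (refl , u<q , _)) _ = ⊥-elim (1+n≰n (<⇒≤ u<q))
    cube-top mn@(u≤q , p≤u , bl) refl refl (passed _) (swapped (refl , s≤s 0<q , e)) =
      ⊥-elim (<⇒≱ (hiN′ 0 0<q (λ ()) (λ e′ → <⇒≢ 0<q (sym e′)) refl (λ e′ → <⇒≢ p≤u (sym e′))) (≤-trans (lo₀ 0<q) (≤-reflexive e)))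
    cube-top mn@(u≤q , p≤u , bl) refl refl (passed _) (passed _) = result
      (inside u≤q p≤u (blocked mn (top refl refl)))
      (top refl refl)
      (λ { k refl k<q → hiN′ k k<q (λ ()) (λ e → <⇒≢ k<q (sym e)) refl (≢-below refl p≤u) })

    -- A swap at level q + 1 alone moves only that hole down and turns `same` into `next`. A swap at
    -- level q alone cannot occur: either `noDiag` forbids it, or interlacing forces the same swap
    -- at level q + 1.
    cube-same : InnerCol → m < q → h ≡ m → X m ≡ Y m → ∀ {u′ m′ p′ h′} → Local q Y m u u′ m′ → Local (suc q) X h p p′ h′ →
      Result u′ m′ p′ h′
    cube-same mn@(u≤q , p≤u , bl) m<q refl e (swapped (refl , u<q , eM)) (swapped (refl , p<q , eN)) = result
      (inside (<⇒≤ m<q) ≤-refl (λ k a b → ⊥-elim (<⇒≱ b a)))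
      (same u<q refl (trans (inc-other X 1+n≢n) (trans (sym eN) (trans e (trans eM (sym (inc-other Y 1+n≢n)))))))
      λ { k refl k<q → ≤-trans (≤-reflexive (sym (inc-same m X))) (≤-trans (proj₂ (i₁ k k<q)) (≤-reflexive (inc-other Y (λ e → 1+n≢n (sym e))))) }
    cube-same mn@(u≤q , p≤u , bl) m<q refl e (swapped (refl , u<q , eM)) (passed ¬s) with m≤n⇒m<n∨m≡n p≤u
    ... | inj₁ (s≤s p≤m) = ⊥-elim (noDiag mn m<q refl p≤m ≤-refl)
    ... | inj₂ refl = ⊥-elim (¬s (refl , m<n⇒m<1+n u<q , ≤-antisym (≤-trans (≤-reflexive (trans e eM)) (lo₀ u<q)) (≤-trans (hi₀ m<q) (≤-reflexive (sym e)))))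
    cube-same mn@(u≤q , p≤u , bl) m<q refl e (passed _) (swapped (refl , p<q , eN)) = result
      (inside u≤q (<⇒≤ p≤u) bl′)
      (next m<q refl (≤-trans (≤-reflexive (cong suc (inc-other Y (<⇒≢ p≤u)))) (≤-reflexive (sym (trans (inc-same m X) (cong suc e))))))
      λ { k refl k<q → ≤-trans (≤-reflexive (sym (inc-same m X))) (≤-trans (proj₂ (i₁ k k<q)) (≤-reflexive (inc-other Y (λ e → 1+n≢n (sym e))))) }
      where
      bl′ : ∀ k → m ≤ k → k < u → X (suc k) ≡ Y k
      bl′ k m≤k k<u with m≤n⇒m<n∨m≡n m≤k
      ... | inj₁ p≤k = blocked mn (same m<q refl e) k p≤k k<u
      ... | inj₂ refl = trans (sym eN) e
    cube-same mn@(u≤q , p≤u , bl) m<q refl e (passed _) (passed ¬s) = result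
      (inside u≤q p≤u (blocked mn (same m<q refl e)))
      (same m<q refl eq)
      ub
      where
      eq : inc p X m ≡ inc u Y m
      eq with m ≟ p | m ≟ u
      ... | yes refl | yes refl = cong suc e
      ... | no _ | no _ = e
      ... | yes refl | no m≢u = ⊥-elim (noDiag mn m<q refl ≤-refl (≤∧≢⇒< p≤u m≢u))
      ... | no m≢p | yes refl = ⊥-elim (1+n≰n (≤-trans (loM m<q refl (λ e′ → m≢p (sym e′))) (≤-reflexive (trans (inc-same m X) (cong suc e)))))
      ub : ∀ k → p ≡ suc k → k < q → X (suc k) < Y k
      ub k refl k<q with m ≟ suc k
      ... | yes refl = s≤s⁻¹ (≤-trans (≤-reflexive (cong suc (sym (inc-same m X)))) (≤-trans (≤-reflexive (sym (inc-same m (inc m X)))) (≤-trans (proj₂ (i₂ k k<q)) (≤-trans (≤-reflexive (trans (inc-other (inc m Y) (λ e′ → ≢-below refl p≤u (sym e′))) (inc-other Y (λ e → 1+n≢n (sym e))))) (n≤1+n _)))))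
      ... | no m≢sk with m ≟ k
      ... | no m≢k = hiN′ k k<q m≢sk m≢k refl (≢-below refl p≤u)
      ... | yes refl = ≤∧≢⇒< (hi₀ k<q) (λ e′ → ¬s (refl , s≤s k<q , trans e (sym e′)))

    -- A swap at level q brings its hole into row m + 1, where the hole of level q + 1 already is,
    -- and turns `next` into `same`. At level q + 1 no swap is possible, since X (h + 1) < Y h ≤ X h
    -- whenever p = h + 1.
    cube-next : InnerCol → m < q → h ≡ suc m → Y m < X m → ∀ {u′ m′ p′ h′} → Local q Y m u u′ m′ → Local (suc q) X h p p′ h′ →
      Result u′ m′ p′ h′
    cube-next mn@(u≤q , p≤u , bl) m<q refl lt _ (swapped (refl , p<q , e)) = ⊥-elim
      (<⇒≱ (hiN′ h h<q (λ e′ → 1+n≢n (sym e′)) (λ e′ → 1+n≢n (sym e′)) refl (≢-below refl p≤u)) (≤-trans (lo₀ h<q) (≤-reflexive e)))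
      where
      h<q : h < q
      h<q = ≤-trans p≤u u≤q
    cube-next mn@(u≤q , p≤u , bl) m<q refl lt (swapped (refl , u<q , eM)) (passed ¬s) with m≤n⇒m<n∨m≡n p≤u
    ... | inj₂ refl = ⊥-elim (<⇒≱ (hiNN m m<q refl refl refl 1+n≢n) (≤-trans (≤-reflexive eM) (lo₀ u<q)))
    ... | inj₁ (s≤s p≤m) = result
      (inside (<⇒≤ m<q) p≤m (λ k p≤k k<m → blocked mn (next m<q refl lt) k p≤k (m<n⇒m<1+n k<m)))
      (same u<q refl (trans (inc-other X (λ e → <⇒≢ (s≤s p≤m) (sym e))) (trans (blocked mn (next m<q refl lt) m p≤m ≤-refl) (trans eM (sym (inc-other Y 1+n≢n))))))
      λ { k refl k<q → hiN′ k k<q (λ e → <⇒≢ p≤m (sym (suc-injective e))) (λ e → <⇒≢ p≤m (sym e)) refl (≢-below refl p≤u) }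
    cube-next mn@(u≤q , p≤u , bl) m<q refl lt (passed _) (passed ¬s) = result
      (inside u≤q p≤u (blocked mn (next m<q refl lt)))
      (next m<q refl lt′)
      ub
      where
      lt′ : inc u Y m < inc p X m
      lt′ with m ≟ p | m ≟ u
      ... | yes refl | yes refl = s≤s lt
      ... | yes refl | no _ = m<n⇒m<1+n lt
      ... | no _ | no _ = lt
      ... | no m≢p | yes refl = ≤-trans (loM m<q refl (λ e → m≢p (sym e))) (≤-reflexive (inc-other X (λ e → 1+n≢n (sym e))))
      ub : ∀ k → p ≡ suc k → k < q → X (suc k) < Y k
      ub k refl k<q with m ≟ k
      ... | yes refl = hiNN k k<q refl refl refl (≢-below refl p≤u)
      ... | no m≢k = hiN′ k k<q (λ e → m≢k (suc-injective e)) m≢k refl (≢-below refl p≤u)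

  cube : ColRule q (inc m Y) (inc h X) u p → RowRule q Y X m h →
    ∀ {u′ m′ p′ h′} → Local q Y m u u′ m′ → Local (suc q) X h p p′ h′ → Result u′ m′ p′ h′
  cube (outside q<u refl) r (swapped (refl , u<q , _)) _ = ⊥-elim (<⇒≱ q<u (<⇒≤ u<q))
  cube (outside q<u refl) r (passed _) (swapped (refl , u<q , _)) = ⊥-elim (<⇒≱ q<u (s≤s⁻¹ u<q))
  cube (outside q<u refl) r (passed _) (passed _) = result (outside q<u refl) (row r) ub
    where
    row : RowRule q Y X m h → RowRule q (inc u Y) (inc p X) m h
    row (outside a b) = outside a b
    row (top a b) = top a b
    row (same a b c) = same a b (inc-cong u {X} {Y} {m} c)
    row (next a b c) = next a b (subst₂ _<_ (sym (inc-other Y (<⇒≢ (<-trans a q<u)))) (sym (inc-other X (<⇒≢ (<-trans a q<u)))) c)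
    ub : ∀ k → p ≡ suc k → k < q → X (suc k) < Y k
    ub k refl k<q = ⊥-elim (<⇒≱ q<u k<q)
  cube (inside u≤q p≤u bl) (outside q<m refl) (swapped (refl , u<q , _)) _ = ⊥-elim (<⇒≱ q<m (<⇒≤ (<-trans ≤-refl u<q)))
  cube (inside u≤q p≤u bl) (outside q<m refl) _ (swapped (refl , p<q , _)) = ⊥-elim (<⇒≱ q<m (≤-trans (n≤1+n _) (s≤s⁻¹ p<q)))
  cube (inside u≤q p≤u bl) (outside q<m refl) (passed _) (passed _) = result
    (inside u≤q p≤u λ k p≤k k<u →
      trans (sym (inc-other X (<⇒≢ (≤-<-trans (≤-trans k<u u≤q) q<m))))
        (trans (bl k p≤k k<u) (inc-other Y (<⇒≢ (<-trans (<-≤-trans k<u u≤q) q<m)))))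
    (outside q<m refl)
    λ { k refl k<q → hiN′ k k<q (λ e → <⇒≢ (≤-<-trans k<q q<m) (sym e)) (λ e → <⇒≢ (<-trans k<q q<m) (sym e)) refl (≢-below refl p≤u) }
  cube (inside a b c) (top d e) = cube-top (a , b , c) d e
  cube (inside a b c) (same d e f) = cube-same (a , b , c) d e f
  cube (inside a b c) (next d e f) = cube-next (a , b , c) d e f

  cube-step : ColRule q (inc m Y) (inc h X) u p → RowRule q Y X m h →
    ∀ {u′ m′ p′ h′} → Local q Y m u u′ m′ → Local (suc q) X h p p′ h′ → Decreasing q (inc u′ Y) →
    ColRule q Y X u′ p′ × RowRule q (inc u′ Y) (inc p′ X) m′ h′ × Interlace q (inc u′ Y) (inc p′ X)
  cube-step c r lM lN d with cube c r lM lN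
  ... | result c′ r′ ub = c′ , r′ , interlace d c′ ub

-- Jeu de taquin on words of rows

module _ (q : ℕ) (y : ℕ → ℕ) where

  -- Swap, expressed by the counts before the deletion: these include the box of the hole in row h.
  Swaps : ℕ → ℕ → Set
  Swaps t h = y (suc t) ≡ suc h × y (suc t) < q × cnt y (suc t) h ≡ suc (cnt y (suc t) (y (suc t)))

  swaps? : ∀ t h → Dec (Swaps t h)
  swaps? t h = (y (suc t) ≟ suc h) ×-dec (y (suc t) <? q) ×-dec (cnt y (suc t) h ≟ suc (cnt y (suc t) (y (suc t))))

  -- Entries are visited in increasing order, so the first one found next to the hole is its smaller
  -- neighbour. `hole t` is the row of the hole when the entries up to t + 1 have been visited;
  -- letter t of `slideWord` is the new row of the entry t + 2, as the first entry is gone.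
  hole : ℕ → ℕ
  hole zero = y 0
  hole (suc t) with swaps? t (hole t)
  ... | yes _ = y (suc t)
  ... | no  _ = hole t

  slideWord : ℕ → ℕ
  slideWord t with swaps? t (hole t)
  ... | yes _ = hole t
  ... | no  _ = y (suc t)

inc-comm : ∀ a b X k → inc a (inc b X) k ≡ inc b (inc a X) k
inc-comm a b X k = split (k ≟ a) (k ≟ b)
  where
  split : Dec (k ≡ a) → Dec (k ≡ b) → inc a (inc b X) k ≡ inc b (inc a X) k
  split (yes refl) (yes refl) = refl
  split (yes refl) (no k≢b) = trans (inc-same k (inc b X)) (trans (cong suc (inc-other X k≢b))
    (sym (trans (inc-other (inc k X) k≢b) (inc-same k X))))
  split (no k≢a) (yes refl) = trans (inc-other (inc k X) k≢a) (trans (inc-same k X)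
    (sym (trans (inc-same k (inc a X)) (cong suc (inc-other X k≢a)))))
  split (no k≢a) (no k≢b) = trans (inc-other (inc b X) k≢a) (trans (inc-other X k≢b)
    (sym (trans (inc-other (inc a X) k≢b) (inc-other X k≢a))))

inc-cong-≗ : ∀ a {X Y} → (∀ k → X k ≡ Y k) → ∀ k → inc a X k ≡ inc a Y k
inc-cong-≗ a {X} {Y} e k = inc-cong a {X} {Y} (e k)

-- A swap exchanges the names of the two boxes that are added; without a swap they are merely added
-- in the other order.
cnt-slide : ∀ q y t k → cnt y (suc t) k ≡ inc (hole q y t) (cnt (slideWord q y) t) k
cnt-slide q y zero k = refl
cnt-slide q y (suc t) k with swaps? q y t (hole q y t)
... | yes _ = inc-cong-≗ (y (suc t)) (cnt-slide q y t) k
... | no _ = trans (inc-cong-≗ (y (suc t)) (cnt-slide q y t) k)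
                   (inc-comm (y (suc t)) (hole q y t) (cnt (slideWord q y) t) k)

-- `Swaps` uses the old counts so that `hole` can be defined before the new word exists. `cnt-slide`
-- translates: row h of the old count contains the box of the hole, row p does not, whence the
-- successor in `Swaps`.
local-slide : ∀ q y t →
  Local q (cnt (slideWord q y) t) (hole q y t) (y (suc t)) (slideWord q y t) (hole q y (suc t))
local-slide q y t with swaps? q y t (hole q y t)
... | yes (e , p<q , c) = swapped (e , p<q , suc-injective (begin
    suc (X h)     ≡⟨ inc-same h X ⟨
    inc h X h     ≡⟨ cnt-slide q y t h ⟨
    cnt y (suc t) h ≡⟨ c ⟩
    suc (cnt y (suc t) p) ≡⟨ cong suc (cnt-slide q y t p) ⟩
    suc (inc h X p) ≡⟨ cong suc (inc-other X (λ e′ → 1+n≢n (trans (sym e) e′))) ⟩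
    suc (X p) ∎))
  where
  open ≡-Reasoning
  h = hole q y t
  p = y (suc t)
  X = cnt (slideWord q y) t
... | no ¬s = passed λ { (e , p<q , c) → ¬s (e , p<q , (begin
    cnt y (suc t) h ≡⟨ cnt-slide q y t h ⟩
    inc h X h ≡⟨ inc-same h X ⟩
    suc (X h) ≡⟨ cong suc c ⟩
    suc (X p) ≡⟨ cong suc (inc-other X (λ e′ → 1+n≢n (trans (sym e) e′))) ⟨
    suc (inc h X p) ≡⟨ cong suc (cnt-slide q y t p) ⟨
    suc (cnt y (suc t) p) ∎)) }
  where
  open ≡-Reasoning
  h = hole q y t
  p = y (suc t)
  X = cnt (slideWord q y) t

letter-outside : ∀ {q X h p p′ h′} → Local q X h p p′ h′ → q ≤ p → p′ ≡ p
letter-outside (swapped (_ , p<q , _)) q≤p = ⊥-elim (<⇒≱ p<q q≤p)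
letter-outside (passed _) _ = refl

hole-outside-local : ∀ {q X h p p′ h′} → Local q X h p p′ h′ → q ≤ h → h′ ≡ h
hole-outside-local (swapped (refl , p<q , _)) q≤h = ⊥-elim (<⇒≱ (<-trans ≤-refl p<q) q≤h)
hole-outside-local (passed _) _ = refl

slideWord-outside : ∀ {q} y t → q ≤ y (suc t) → slideWord q y t ≡ y (suc t)
slideWord-outside {q} y t = letter-outside (local-slide q y t)

hole-outside : ∀ {q} y → q ≤ y 0 → ∀ t → hole q y t ≡ y 0
hole-outside y q≤ zero = refl
hole-outside {q} y q≤ (suc t) = trans (hole-outside-local (local-slide q y t) (≤-trans q≤ (≤-reflexive (sym ih)))) ih
  where
  ih : hole q y t ≡ y 0
  ih = hole-outside y q≤ t

Decreasing-cong : ∀ {q X Y} → (∀ k → X k ≡ Y k) → Decreasing q X → Decreasing q Y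
Decreasing-cong e d k k<q = subst₂ _≤_ (e _) (e _) (d k k<q)

Interlace-cong : ∀ {q Y X Y′ X′} → (∀ k → Y k ≡ Y′ k) → (∀ k → X k ≡ X′ k) → Interlace q Y X → Interlace q Y′ X′
Interlace-cong e f i k k<q = subst₂ _≤_ (e _) (f _) (proj₁ (i k k<q)) , subst₂ _≤_ (f _) (e _) (proj₂ (i k k<q))

ColRule-cong : ∀ {q M N M′ N′ u p} → (∀ k → M k ≡ M′ k) → (∀ k → N k ≡ N′ k) → ColRule q M N u p → ColRule q M′ N′ u p
ColRule-cong e f (outside a b) = outside a b
ColRule-cong e f (inside a b c) = inside a b (λ k k≤ k< → trans (sym (f _)) (trans (c k k≤ k<) (e _)))

slide-decreasing : ∀ {q y} → (∀ t → Decreasing q (cnt y t)) → ∀ t → Decreasing q (cnt (slideWord q y) t)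
slide-decreasing d zero = λ _ _ → z≤n
slide-decreasing {q} {y} d (suc t) = decreasing-local (local-slide q y t)
  (slide-decreasing d t)
  (Decreasing-cong (cnt-slide q y t) (d (suc t)))
  (Decreasing-cong (inc-cong-≗ (y (suc t)) (cnt-slide q y t)) (d (suc (suc t))))

-- One deletion preserves the coupling of consecutive levels

record Coupled (q : ℕ) (u p : ℕ → ℕ) : Set where
  field
    interlace : ∀ t → Interlace q (cnt u t) (cnt p t)
    colRule : ∀ t → ColRule q (cnt u t) (cnt p t) (u t) (p t)

open Coupled

module _ {q : ℕ} {u p : ℕ → ℕ} (d : ∀ t → Decreasing q (cnt u t)) (c : Coupled q u p) where

  private
    Y X : ℕ → ℕ → ℕ
    Y = cnt (slideWord q u)
    X = cnt (slideWord (suc q) p)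

    first-zero : u 0 ≤ q → p 0 ≤ u 0 → p 0 ≡ 0
    first-zero u≤q p≤u = go (p 0) refl
      where
      go : ∀ k → p 0 ≡ k → p 0 ≡ 0
      go zero e = e
      go (suc k) e = ⊥-elim (<⇒≱ (≤-trans (≤-reflexive (sym (inc-same (suc k) (λ _ → 0))))
            (subst (λ z → inc z (λ _ → 0) (suc k) ≤ inc (u 0) (λ _ → 0) k) e (proj₂ (interlace c 1 k (≤-trans k<u u≤q)))))
            (≤-reflexive (inc-other (λ _ → 0) (<⇒≢ k<u))))
        where
        k<u : k < u 0
        k<u = subst (_≤ u 0) e p≤u

  -- On empty shapes interlacing leaves only row 0 for the first box, so the holes start with `top`
  -- or `same`, never with `next`.
  row-first : RowRule q (Y 0) (X 0) (u 0) (p 0)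
  row-first with colRule c 0
  ... | outside q<u e = outside q<u e
  ... | inside u≤q p≤u _ with first-zero u≤q p≤u | m≤n⇒m<n∨m≡n u≤q
  ... | p≡0 | inj₂ e = top e p≡0
  ... | p≡0 | inj₁ u<q = same u<q p≡u refl
    where
    p≡u : p 0 ≡ u 0
    p≡u with u 0 ≟ p 0
    ... | yes e = sym e
    ... | no ne = ⊥-elim (<⇒≱ (≤-trans (≤-reflexive (sym (inc-same (u 0) (λ _ → 0)))) (proj₁ (interlace c 1 (u 0) u<q)))
                     (≤-reflexive (inc-other (λ _ → 0) ne)))

  -- A row of cubes: `rowInterlace t` is the face through which the holes enter cube t, `c` supplies
  -- the face with the old letters, and `faces t` returns the face with the new letters and the face
  -- shared with cube t + 1.
  rowInterlace : ∀ t → RowRule q (Y t) (X t) (hole q u t) (hole (suc q) p t) × Interlace q (Y t) (X t)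
  faces : ∀ t → ColRule q (Y t) (X t) (slideWord q u t) (slideWord (suc q) p t) ×
    RowRule q (Y (suc t)) (X (suc t)) (hole q u (suc t)) (hole (suc q) p (suc t)) × Interlace q (Y (suc t)) (X (suc t))

  faces t = Cube.cube-step (proj₂ (rowInterlace t))
    (Interlace-cong (cnt-slide q u t) (cnt-slide (suc q) p t) (interlace c (suc t)))
    (Interlace-cong (inc-cong-≗ (u (suc t)) (cnt-slide q u t)) (inc-cong-≗ (p (suc t)) (cnt-slide (suc q) p t)) (interlace c (suc (suc t))))
    (ColRule-cong (cnt-slide q u t) (cnt-slide (suc q) p t) (colRule c (suc t)))
    (proj₁ (rowInterlace t)) (local-slide q u t) (local-slide (suc q) p t) (slide-decreasing d (suc t))

  rowInterlace zero = row-first , λ _ _ → z≤n , z≤n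
  rowInterlace (suc t) = proj₂ (faces t)

  coupled-slide : Coupled q (slideWord q u) (slideWord (suc q) p)
  coupled-slide = record { interlace = λ t → proj₂ (rowInterlace t) ; colRule = λ t → proj₁ (faces t) }

-- Evacuation of rectangular words

slides : ℕ → (ℕ → ℕ) → ℕ → ℕ → ℕ
slides q y zero = y
slides q y (suc i) = slideWord q (slides q y i)

slides-outside : ∀ q y i t → q ≤ y (i + t) → slides q y i t ≡ y (i + t)
slides-outside q y zero t _ = refl
slides-outside q y (suc i) t q≤ = trans (slideWord-outside (slides q y i) t (subst (q ≤_) (sym e) q≤)) e
  where
  e : slides q y i (suc t) ≡ y (suc i + t)
  e = trans (slides-outside q y i (suc t) (subst (λ z → q ≤ y z) (sym (+-suc i t)) q≤)) (cong y (+-suc i t))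

record RectangularWord (r c : ℕ) (y : ℕ → ℕ) : Set where
  field
    ballot : ∀ t → Decreasing r (cnt y t)
    full : ∀ a → a < r → cnt y (r * c) a ≡ c

module _ {r c : ℕ} {y : ℕ → ℕ} (rect : RectangularWord r c y) where
  open RectangularWord rect

  slides-decreasing : ∀ q → q ≤ r → ∀ i t → Decreasing q (cnt (slides q y i) t)
  slides-decreasing q q≤r zero t k k<q = ballot t k (≤-trans k<q q≤r)
  slides-decreasing q q≤r (suc i) = slide-decreasing (slides-decreasing q q≤r i)

  -- Before the first slide all levels carry the same word; interlacing is then the ballot
  -- condition, and no letter is moved between levels.
  slides-coupled : ∀ q → q < r → ∀ i → Coupled q (slides q y i) (slides (suc q) y i)
  slides-coupled q q<r zero = record
    { interlace = λ t k k<q → ≤-refl , ballot t k (≤-trans (s≤s k<q) q<r)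
    ; colRule = rule }
    where
    rule : ∀ t → ColRule q (cnt y t) (cnt y t) (y t) (y t)
    rule t with y t ≤? q
    ... | yes y≤q = inside y≤q ≤-refl (λ k a b → ⊥-elim (<⇒≱ b a))
    ... | no y≰q = outside (≰⇒> y≰q) refl
  slides-coupled q q<r (suc i) = coupled-slide (slides-decreasing q (<⇒≤ q<r) i) (slides-coupled q q<r i)

  -- Row k of the shape at level k + k′ + 1 after i promotions and row k′ of the shape of the first i entries fill a row.
  ComplementAt : ℕ → ℕ → Set
  ComplementAt i d = ∀ k k′ → suc (k + k′) ≤ r → cnt (slides (suc (k + k′)) y i) d k + cnt y i k′ ≡ c

  -- Induction on the level, starting from `top` at level `y i`. If `same` held at some level, the
  -- complement for i + 1 would make rows a and a + 1 of the first i + 1 entries equally long,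
  -- although row a = `y i` has just received a box.
  hole-complement : ∀ i d → ComplementAt (suc i) d →
    ∀ k → suc (k + y i) ≤ r → hole (suc (k + y i)) (slides (suc (k + y i)) y i) d ≡ k
  hole-complement i d comp zero ≤r
    with proj₁ (rowInterlace (slides-decreasing (y i) (<⇒≤ ≤r) i) (slides-coupled (y i) ≤r i) d)
       | trans (hole-outside (slides (y i) y i) (≤-reflexive (sym first)) d) first
    where
    first : slides (y i) y i 0 ≡ y i
    first = trans (slides-outside (y i) y i 0 (≤-reflexive (sym (cong y (+-identityʳ i))))) (cong y (+-identityʳ i))
  ... | outside lt _ | e = ⊥-elim (<⇒≢ lt (sym e))
  ... | top _ h≡0 | _ = h≡0
  ... | same lt _ _ | e = ⊥-elim (<⇒≢ lt e)
  ... | next lt _ _ | e = ⊥-elim (<⇒≢ lt e)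
  hole-complement i d comp (suc k) ≤r
    with proj₁ (rowInterlace (slides-decreasing (suc k + y i) (<⇒≤ ≤r) i) (slides-coupled (suc k + y i) ≤r i) d)
       | hole-complement i d comp k (<⇒≤ ≤r)
  ... | outside lt _ | e = ⊥-elim (<⇒≱ lt (≤-trans (≤-reflexive e) (m≤n⇒m≤1+n (m≤m+n k (y i)))))
  ... | top e′ _ | e = ⊥-elim (<⇒≢ (s≤s (m≤m+n k (y i))) (trans (sym e) e′))
  ... | next _ e′ _ | e = trans e′ (cong suc e)
  ... | same _ _ X≡Y | e = ⊥-elim (<⇒≢ (s≤s (ballot i a a<r)) (begin
    cnt y i (suc a) ≡⟨ inc-other (cnt y i) 1+n≢n ⟨
    cnt y (suc i) (suc a) ≡⟨ +-cancelˡ-≡ (X k) _ _ (trans Xc (trans (sym Yc) (cong (_+ cnt y (suc i) a) (sym X≡Y′)))) ⟩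
    cnt y (suc i) a ≡⟨ inc-same a (cnt y i) ⟩
    suc (cnt y i a) ∎))
    where
    open ≡-Reasoning
    a = y i
    X = cnt (slides (suc (suc k + a)) y (suc i)) d
    Y = cnt (slides (suc k + a) y (suc i)) d
    X≡Y′ : X k ≡ Y k
    X≡Y′ = subst (λ m → X m ≡ Y m) e X≡Y
    a<r : suc a < r
    a<r = ≤-trans (s≤s (s≤s (m≤n+m a k))) ≤r
    Xc : X k + cnt y (suc i) (suc a) ≡ c
    Xc = subst (λ q → cnt (slides (suc q) y (suc i)) d k + cnt y (suc i) (suc a) ≡ c) (+-suc k a)
           (comp k (suc a) (subst (λ q → suc q ≤ r) (sym (+-suc k a)) ≤r))
    Yc : Y k + cnt y (suc i) a ≡ c
    Yc = comp k a (<⇒≤ ≤r)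

  -- Induction from the end of the word, where nothing is left and all rows of y have length c.
  -- Going back from i + 1 to i, the hole restores a box in row k exactly when k′ = `y i` loses one;
  -- this is `hole-complement`.
  complement : ∀ d i → i + d ≡ r * c → ComplementAt i d
  complement zero i e k k′ ≤r = trans (cong (λ z → cnt y z k′) (trans (sym (+-identityʳ i)) e)) (full k′ (≤-trans (s≤s (m≤n+m k′ k)) ≤r))
  complement (suc d) i e k k′ ≤r = begin
    cnt W (suc d) k + cnt y i k′ ≡⟨ cong (_+ cnt y i k′) (cnt-slide q W d k) ⟩
    inc (hole q W d) X k + cnt y i k′ ≡⟨ shift (q ≤? y i) ⟩
    X k + cnt y (suc i) k′ ≡⟨ ih k k′ ≤r ⟩
    c ∎
    where
    open ≡-Reasoning
    q = suc (k + k′)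
    W = slides q y i
    X = cnt (slides q y (suc i)) d
    ih : ComplementAt (suc i) d
    ih = complement d (suc i) (trans (sym (+-suc i d)) e)
    i<n : i < r * c
    i<n = ≤-trans (s≤s (m≤m+n i d)) (≤-reflexive (trans (sym (+-suc i d)) e))
    both-other : ∀ {h} → k ≢ h → k′ ≢ y i → inc h X k + cnt y i k′ ≡ X k + cnt y (suc i) k′
    both-other k≢ k′≢ = cong₂ _+_ (inc-other X k≢) (sym (inc-other (cnt y i) k′≢))
    shift : Dec (q ≤ y i) → inc (hole q W d) X k + cnt y i k′ ≡ X k + cnt y (suc i) k′
    -- The deleted entry is absent at this level: its hole stays in row `y i` ≥ q, and neither k nor
    -- k′ is that row.
    shift (yes q≤) = both-other
      (λ k≡ → <⇒≱ (≤-trans (s≤s (m≤m+n k k′)) q≤) (≤-reflexive (sym (trans k≡ atStart))))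
      (<⇒≢ (≤-trans (s≤s (m≤n+m k′ k)) q≤))
      where
      first : W 0 ≡ y i
      first = trans (slides-outside q y i 0 (subst (λ z → q ≤ y z) (sym (+-identityʳ i)) q≤)) (cong y (+-identityʳ i))
      atStart : hole q W d ≡ y i
      atStart = trans (hole-outside W (≤-trans q≤ (≤-reflexive (sym first))) d) first
    shift (no q≰) with m≤n⇒∃[o]m+o≡n (≰⇒> q≰)
    ... | h , e′ with k ≟ h
    ... | yes refl = trans (cong (λ z → inc z X k + cnt y i k′) at) (trans (cong (_+ cnt y i k′) (inc-same k X))
                      (trans (sym (+-suc (X k) _)) (cong (X k +_) (trans (cong (λ z → suc (cnt y i z)) k′≡) (trans (sym (inc-same (y i) (cnt y i))) (cong (cnt y (suc i)) (sym k′≡)))))))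
      where
      k′≡ : k′ ≡ y i
      k′≡ = +-cancelˡ-≡ k _ _ (trans (sym (suc-injective e′)) (+-comm (y i) k))
      at : hole q W d ≡ k
      at = subst (λ q → hole q (slides q y i) d ≡ k) (cong (λ z → suc (k + z)) (sym k′≡))
             (hole-complement i d ih k (subst (λ z → suc (k + z) ≤ r) k′≡ ≤r))
    ... | no k≢h = trans (cong (λ z → inc z X k + cnt y i k′) at) (both-other k≢h
           (λ k′≡ → k≢h (+-cancelʳ-≡ (y i) _ _ (trans (cong (k +_) (sym k′≡)) q≡)) ))
      where
      q≡ : k + k′ ≡ h + y i
      q≡ = trans (sym (suc-injective e′)) (+-comm (y i) h)
      at : hole q W d ≡ h
      at = subst (λ q → hole (suc q) (slides (suc q) y i) d ≡ h) (sym q≡)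
             (hole-complement i d ih h (subst (λ z → suc z ≤ r) q≡ ≤r))

-- Standard tableaux as words of rows and columns

∈-cells⁻ : ∀ R c {p} → p ∈ cells R c → proj₁ p < R × proj₂ p < c
∈-cells⁻ R c p∈ with find (∈-concatMap⁻ (λ i → map (λ j → (i , j)) (upTo c)) {xs = upTo R} p∈)
... | i , i∈ , p∈′ with ∈-map⁻ (λ j → (i , j)) p∈′
... | j , j∈ , refl = ∈-upTo⁻ i∈ , ∈-upTo⁻ j∈

∈-cells⁺ : ∀ {R c i j} → i < R → j < c → (i , j) ∈ cells R c
∈-cells⁺ {R} {c} {i} i<R j<c =
  ∈-concatMap⁺ (λ i → map (λ j → (i , j)) (upTo c)) (lose (∈-upTo⁺ i<R) (∈-map⁺ (i ,_) (∈-upTo⁺ j<c)))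

∈-oneTo⁻ : ∀ {N v} → v ∈ oneTo N → ∃ λ t → v ≡ suc t × t < N
∈-oneTo⁻ v∈ with ∈-map⁻ suc v∈
... | t , t∈ , e = t , e , ∈-upTo⁻ t∈

map-unique-injective : ∀ {A B : Set} (f : A → B) {xs x y} → Unique (map f xs) → x ∈ xs → y ∈ xs → f x ≡ f y → x ≡ y
map-unique-injective f u (here refl) (here refl) e = refl
map-unique-injective f (a ∷ u) (here refl) (there y∈) e = ⊥-elim (All.lookup a (∈-map⁺ f y∈) e)
map-unique-injective f (a ∷ u) (there x∈) (here refl) e = ⊥-elim (All.lookup a (∈-map⁺ f x∈) (sym e))
map-unique-injective f (a ∷ u) (there x∈) (there y∈) e = map-unique-injective f u x∈ y∈ e

record Standard (N R c : ℕ) (T : Tab) : Set where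
  field
    row-step : ∀ i j → i < R → suc j < c → T i j < T i (suc j)
    col-step : ∀ i j → suc i < R → j < c → T i j < T (suc i) j
    positive : ∀ i j → i < R → j < c → 1 ≤ T i j
    bounded : ∀ i j → i < R → j < c → T i j ≤ N
    injective : ∀ {i j i′ j′} → i < R → j < c → i′ < R → j′ < c → T i j ≡ T i′ j′ → i ≡ i′ × j ≡ j′
    locate : ∀ t → t < N → ∃₂ λ i j → i < R × j < c × T i j ≡ suc t

transposed : ∀ {N R c T} → Standard N R c T → Standard N c R (λ i j → T j i)
transposed s = record
  { row-step = λ i j i< j< → col-step j i j< i<
  ; col-step = λ i j i< j< → row-step j i j< i<
  ; positive = λ i j i< j< → positive j i j< i<
  ; bounded = λ i j i< j< → bounded j i j< i<
  ; injective = λ i< j< i′< j′< e → swap (injective j< i< j′< i′< e)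
  ; locate = λ t t< → let (i , j , i< , j< , e) = locate t t< in j , i , j< , i< , e }
  where open Standard s
        open import Data.Product using (swap)

syt-standard : ∀ {R c T} → IsSYT R c T → Standard (R * c) R c T
syt-standard {R} {c} {T} syt = record
  { row-step = rowInc
  ; col-step = colInc
  ; positive = λ i j i< j< → let (t , e , _) = value i< j< in subst (1 ≤_) (sym e) (s≤s z≤n)
  ; bounded = λ i j i< j< → let (t , e , t<) = value i< j< in subst (_≤ R * c) (sym e) t<
  ; injective = λ i< j< i′< j′< e → let e′ = map-unique-injective f unique (∈-cells⁺ i< j<) (∈-cells⁺ i′< j′<) e in cong proj₁ e′ , cong proj₂ e′
  ; locate = loc }
  where
  open IsSYT syt
  f : ℕ × ℕ → ℕ
  f p = T (proj₁ p) (proj₂ p)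
  unique : Unique (entries R c T)
  unique = SetoidPermutation.Unique-resp-↭ (setoid ℕ) (↭⇒↭ₛ (↭-sym perm)) (Unique.map⁺ suc-injective (Unique.upTo⁺ (R * c)))
  value : ∀ {i j} → i < R → j < c → ∃ λ t → T i j ≡ suc t × t < R * c
  value i< j< = ∈-oneTo⁻ (∈-resp-↭ perm (∈-map⁺ f (∈-cells⁺ i< j<)))
  loc : ∀ t → t < R * c → ∃₂ λ i j → i < R × j < c × T i j ≡ suc t
  loc t t< with ∈-map⁻ f (∈-resp-↭ (↭-sym perm) (∈-map⁺ suc (∈-upTo⁺ t<)))
  ... | (i , j) , p∈ , e = i , j , proj₁ (∈-cells⁻ R c p∈) , proj₂ (∈-cells⁻ R c p∈) , sym e

module Cells {N R c : ℕ} {T : Tab} (s : Standard N R c T) where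
  open Standard s

  row-strict : ∀ {i j j′} → i < R → j < j′ → j′ < c → T i j < T i j′
  row-strict {i} {j} {suc j′} i< (s≤s j≤j′) j′< with m≤n⇒m<n∨m≡n j≤j′
  ... | inj₂ refl = row-step i j i< j′<
  ... | inj₁ j<j′ = <-trans (row-strict i< j<j′ (<-trans ≤-refl j′<)) (row-step i j′ i< j′<)

  rowOf colOf : ℕ → ℕ
  rowOf t with t <? N
  ... | yes t<N = proj₁ (locate t t<N)
  -- Past the last entry the letter is R, which counts as absent at every level up to R and
  -- therefore never moves.
  ... | no _ = R
  colOf t with t <? N
  ... | yes t<N = proj₁ (proj₂ (locate t t<N))
  ... | no _ = c

  rowOf-outside : ∀ t → N ≤ t → rowOf t ≡ R
  rowOf-outside t N≤t with t <? N
  ... | yes t<N = contradiction t<N (≤⇒≯ N≤t)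
  ... | no _ = refl

  rowOf< : ∀ t → t < N → rowOf t < R
  rowOf< t t< with t <? N
  ... | yes t<N = let (_ , _ , i< , _) = locate t t<N in i<
  ... | no ¬t = contradiction t< ¬t

  colOf< : ∀ t → t < N → colOf t < c
  colOf< t t< with t <? N
  ... | yes t<N = let (_ , _ , _ , j< , _) = locate t t<N in j<
  ... | no ¬t = contradiction t< ¬t

  entry : ∀ t → t < N → T (rowOf t) (colOf t) ≡ suc t
  entry t t< with t <? N
  ... | yes t<N = let (_ , _ , _ , _ , e) = locate t t<N in e
  ... | no ¬t = contradiction t< ¬t

  location : ∀ {i j} t → i < R → j < c → T i j ≡ suc t → rowOf t ≡ i × colOf t ≡ j
  location {i} {j} t i< j< e = injective (rowOf< t t<N) (colOf< t t<N) i< j< (trans (entry t t<N) (sym e))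
    where
    t<N : t < N
    t<N = subst (_≤ N) e (bounded i j i< j<)

  private
    y = rowOf

  -- The entries ≤ t of row i occupy its first `cnt y t i` columns. This translates between counting
  -- letters and comparing entries.
  record Thresholds (t : ℕ) : Set where
    field
      cnt≤ : ∀ i → i < R → cnt y t i ≤ c
      below : ∀ i j → i < R → j < c → j < cnt y t i → T i j ≤ t
      above : ∀ i j → i < R → j < c → cnt y t i ≤ j → t < T i j

  open Thresholds

  private
    cnt≤col : ∀ t → Thresholds t → (t< : t < N) → cnt y t (y t) ≤ colOf t
    cnt≤col t th t< = ≮⇒≥ λ lt → <⇒≱ (subst (t <_) (sym (entry t t<)) ≤-refl) (below th _ _ (rowOf< t t<) (colOf< t t<) lt)

    cnt≡col : ∀ t → Thresholds t → (t< : t < N) → cnt y t (y t) ≡ colOf t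
    cnt≡col t th t< with m≤n⇒m<n∨m≡n (cnt≤col t th t<)
    ... | inj₂ e = e
    ... | inj₁ lt = ⊥-elim (<⇒≱ (above th (y t) (cnt y t (y t)) (rowOf< t t<) (<-trans lt (colOf< t t<)) ≤-refl)
                     (s≤s⁻¹ (subst (T (y t) (cnt y t (y t)) <_) (entry t t<) (row-strict (rowOf< t t<) lt (colOf< t t<)))))

  thresholds : ∀ t → Thresholds t
  thresholds zero = record
    { cnt≤ = λ _ _ → z≤n
    ; below = λ _ _ _ _ ()
    ; above = λ i j i< j< _ → positive i j i< j< }
  thresholds (suc t) with t <? N
  ... | no t≮ = record
    { cnt≤ = λ i i< → subst (_≤ c) (sym (unchanged i<)) (cnt≤ th i i<)
    ; below = λ i j i< j< lt → m≤n⇒m≤1+n (below th i j i< j< (subst (j <_) (unchanged i<) lt))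
    ; above = λ i j i< j< le → ⊥-elim (<⇒≱ (above th i j i< j< (subst (_≤ j) (unchanged i<) le)) (≤-trans (bounded i j i< j<) (≮⇒≥ t≮))) }
    where
    th = thresholds t
    unchanged : ∀ {i} → i < R → cnt y (suc t) i ≡ cnt y t i
    unchanged i< = inc-other (cnt y t) (λ e → <⇒≢ i< (trans e (rowOf-outside t (≮⇒≥ t≮))))
  ... | yes t< = record { cnt≤ = cnt≤′ ; below = below′ ; above = above′ }
    where
    th = thresholds t
    a = y t
    b = colOf t
    at : cnt y (suc t) a ≡ suc b
    at = trans (inc-same a (cnt y t)) (cong suc (cnt≡col t th t<))
    cnt≤′ : ∀ i → i < R → cnt y (suc t) i ≤ c
    cnt≤′ i i< with i ≟ a
    ... | yes refl = subst (_< c) (sym (cnt≡col t th t<)) (colOf< t t<)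
    ... | no _ = cnt≤ th i i<
    below′ : ∀ i j → i < R → j < c → j < cnt y (suc t) i → T i j ≤ suc t
    below′ i j i< j< lt with i ≟ a
    ... | no _ = m≤n⇒m≤1+n (below th i j i< j< lt)
    ... | yes refl with m≤n⇒m<n∨m≡n (s≤s⁻¹ (subst (j <_) (cong suc (cnt≡col t th t<)) lt))
    ... | inj₂ refl = ≤-reflexive (entry t t<)
    ... | inj₁ j<b = ≤-trans (<⇒≤ (row-strict i< j<b (colOf< t t<))) (≤-reflexive (entry t t<))
    above′ : ∀ i j → i < R → j < c → cnt y (suc t) i ≤ j → suc t < T i j
    above′ i j i< j< le with i ≟ a
    ... | no i≢a = ≤∧≢⇒< (above th i j i< j< le) (λ e → i≢a (sym (proj₁ (location t i< j< (sym e)))))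
    ... | yes refl = subst (_< T i j) (entry t t<) (row-strict i< (subst (_< j) (cnt≡col t th t<) le) j<)

  cnt-row : ∀ t → t < N → cnt y t (y t) ≡ colOf t
  cnt-row t = cnt≡col t (thresholds t)

module _ {N R c : ℕ} {T : Tab} (s : Standard N R c T) where
  open Standard s
  private module Row = Cells s
  private module Col = Cells (transposed s)

  Col-rowOf : ∀ t → Col.rowOf t ≡ Row.colOf t
  Col-rowOf t with t <? N
  ... | yes _ = refl
  ... | no _ = refl

syt-word : ∀ {R c T} (syt : IsSYT R c T) → RectangularWord R c (Cells.rowOf (syt-standard syt))
syt-word {R} {c} {T} syt = record
  { ballot = ballot
  ; full = λ a a< → ≤-antisym (cnt≤ (thresholds n) a a<) (≮⇒≥ λ lt → <⇒≱ (above (thresholds n) a _ a< lt ≤-refl) (bounded a _ a< lt)) }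
  where
  s = syt-standard syt
  n = R * c
  open Standard s
  open Cells s
  open Thresholds
  ballot : ∀ t → Decreasing R (cnt rowOf t)
  ballot t k k< = ≮⇒≥ λ lt →
    let th = thresholds t ; j< = <-≤-trans lt (cnt≤ th (suc k) k<)
    in <⇒≱ (<-trans (above th k _ (<⇒≤ k<) j< ≤-refl) (col-step k _ k< j<)) (below th (suc k) _ k< j< lt)

cnt-cong : ∀ {y z} → (∀ t → y t ≡ z t) → ∀ t k → cnt y t k ≡ cnt z t k
cnt-cong e zero k = refl
cnt-cong {y} {z} e (suc t) k = trans (inc-cong-≗ (y t) (cnt-cong e t) k) (cong (λ a → inc a (cnt z t) k) (e t))

-- y t and z t are the row and the column of the entry t + 1.
record Chart (n r c : ℕ) (T : Tab) (y z : ℕ → ℕ) : Set where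
  field
    row< : ∀ t → t < n → y t < r
    col< : ∀ t → t < n → z t < c
    entry : ∀ t → t < n → T (y t) (z t) ≡ suc t
    row-count : ∀ t → t < n → cnt y t (y t) ≡ z t
    col-count : ∀ t → t < n → cnt z t (z t) ≡ y t
    row-cnt≤ : ∀ t i → i < r → cnt y t i ≤ c
    col-cnt≤ : ∀ t j → j < c → cnt z t j ≤ r
    row-below : ∀ t i j → i < r → j < c → j < cnt y t i → T i j ≤ t
    row-above : ∀ t i j → i < r → j < c → cnt y t i ≤ j → t < T i j
    col-below : ∀ t i j → i < r → j < c → i < cnt z t j → T i j ≤ t
    col-above : ∀ t i j → i < r → j < c → cnt z t j ≤ i → t < T i j

standard-chart : ∀ {n r c T} (s : Standard n r c T) → Chart n r c T (Cells.rowOf s) (Cells.colOf s)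
standard-chart {n} {r} {c} s = record
  { row< = R.rowOf<
  ; col< = R.colOf<
  ; entry = R.entry
  ; row-count = R.cnt-row
  ; col-count = λ t t< → trans (sym (agree t (R.colOf t))) (trans (cong (cnt K.rowOf t) (sym (Col-rowOf s t))) (trans (K.cnt-row t t<) (Col-colOf t)))
  ; row-cnt≤ = λ t → R.Thresholds.cnt≤ (R.thresholds t)
  ; col-cnt≤ = λ t j j< → subst (_≤ r) (agree t j) (K.Thresholds.cnt≤ (K.thresholds t) j j<)
  ; row-below = λ t → R.Thresholds.below (R.thresholds t)
  ; row-above = λ t → R.Thresholds.above (R.thresholds t)
  ; col-below = λ t i j i< j< lt → K.Thresholds.below (K.thresholds t) j i j< i< (subst (i <_) (sym (agree t j)) lt)
  ; col-above = λ t i j i< j< le → K.Thresholds.above (K.thresholds t) j i j< i< (subst (_≤ i) (sym (agree t j)) le) }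
  where
  module R = Cells s
  module K = Cells (transposed s)
  agree : ∀ t j → cnt K.rowOf t j ≡ cnt R.colOf t j
  agree = cnt-cong (Col-rowOf s)
  Col-colOf : ∀ t → K.colOf t ≡ R.rowOf t
  Col-colOf t with t <? n
  ... | yes _ = refl
  ... | no _ = refl

-- Robinson-Schensted insertion of the crossing word

<ᵇ-true : ∀ {m n} → m < n → (m <ᵇ n) ≡ true
<ᵇ-true {m} {n} lt with m <ᵇ n | <⇒<ᵇ lt
... | true | _ = refl

<ᵇ-false : ∀ {m n} → n ≤ m → (m <ᵇ n) ≡ false
<ᵇ-false {m} {n} le with m <ᵇ n in eq
... | false = refl
... | true = ⊥-elim (<⇒≱ (<ᵇ⇒< m n (subst T (sym eq) tt)) le)

applyUpTo-cong : ∀ {A : Set} {f g : ℕ → A} n → (∀ k → k < n → f k ≡ g k) → applyUpTo f n ≡ applyUpTo g n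
applyUpTo-cong zero e = refl
applyUpTo-cong (suc n) e = cong₂ _∷_ (e 0 (s≤s z≤n)) (applyUpTo-cong n (λ k k<n → e (suc k) (s≤s k<n)))

bump-append : ∀ x f n → (∀ k → k < n → f k ≤ x) → bump x (applyUpTo f n) ≡ (applyUpTo f n ∷ʳ x , nothing)
bump-append x f zero _ = refl
bump-append x f (suc n) le rewrite <ᵇ-false (le 0 (s≤s z≤n)) | bump-append x (f ∘ suc) n (λ k k< → le (suc k) (s≤s k<)) = refl

bump-replace : ∀ x f g n a → a < n → (∀ k → k < a → f k ≤ x) → x < f a → g a ≡ x → (∀ k → k < n → k ≢ a → g k ≡ f k) →
  bump x (applyUpTo f n) ≡ (applyUpTo g n , just (f a))
bump-replace x f g (suc n) zero _ le lt refl other rewrite <ᵇ-true lt =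
  cong (λ l → x ∷ l , just (f 0)) (sym (applyUpTo-cong n (λ k k< → other (suc k) (s≤s k<) (λ ()))))
bump-replace x f g (suc n) (suc a) (s≤s a<n) le lt e other
  rewrite <ᵇ-false (le 0 (s≤s z≤n))
        | bump-replace x (f ∘ suc) (g ∘ suc) n a a<n (λ k k< → le (suc k) (s≤s k<)) lt e (λ k k< ne → other (suc k) (s≤s k<) (λ e′ → ne (suc-injective e′)))
        | other 0 (s≤s z≤n) (λ ()) = refl

-- For an insertion whose bumping path is known in advance: `x k` arrives in row k, and the path
-- ends in row j, either by appending to it or, if j = m, by opening it.
insertP-column : ∀ (x : ℕ → ℕ) (G G′ : ℕ → List ℕ) m m′ j →
  (∀ k → k < j → k < m × bump (x k) (G k) ≡ (G′ k , just (x (suc k)))) →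
  (j < m × m′ ≡ m × bump (x j) (G j) ≡ (G′ j , nothing)) ⊎ (j ≡ m × m′ ≡ suc m × G′ j ≡ [ x j ]) →
  (∀ k → j < k → k < m → G′ k ≡ G k) →
  insertP (x 0) (applyUpTo G m) ≡ (applyUpTo G′ m′ , j)
insertP-column x G G′ m m′ zero _ (inj₂ (refl , refl , e)) _ = cong (λ l → l ∷ [] , 0) (sym e)
insertP-column x G G′ (suc m) m′ zero _ (inj₁ (_ , refl , e)) rest rewrite e =
  cong (λ l → G′ 0 ∷ l , 0) (sym (applyUpTo-cong m (λ k k< → rest (suc k) (s≤s z≤n) (s≤s k<))))
insertP-column x G G′ zero m′ (suc j) bumps _ _ with proj₁ (bumps 0 (s≤s z≤n))
... | ()
insertP-column x G G′ (suc m) m′ (suc j) bumps end rest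
  rewrite proj₂ (bumps 0 (s≤s z≤n))
  = trans (cong (λ res → G′ 0 ∷ proj₁ res , suc (proj₂ res)) ih) (out end)
  where
  pre : ℕ → ℕ
  pre (suc k) = k
  pre zero = 0
  end′ : (suc j < suc m × m′ ≡ suc m × bump (x (suc j)) (G (suc j)) ≡ (G′ (suc j) , nothing)) ⊎ (suc j ≡ suc m × m′ ≡ suc (suc m) × G′ (suc j) ≡ [ x (suc j) ]) →
    (j < m × pre m′ ≡ m × bump (x (suc j)) (G (suc j)) ≡ (G′ (suc j) , nothing)) ⊎ (j ≡ m × pre m′ ≡ suc m × G′ (suc j) ≡ [ x (suc j) ])
  end′ (inj₁ (s≤s a , refl , b)) = inj₁ (a , refl , b)
  end′ (inj₂ (refl , refl , b)) = inj₂ (refl , refl , b)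
  ih : insertP (x 1) (applyUpTo (G ∘ suc) m) ≡ (applyUpTo (G′ ∘ suc) (pre m′) , j)
  ih = insertP-column (x ∘ suc) (G ∘ suc) (G′ ∘ suc) m (pre m′) j
    (λ k k< → s≤s⁻¹ (proj₁ (bumps (suc k) (s≤s k<))) , proj₂ (bumps (suc k) (s≤s k<)))
    (end′ end) (λ k j< k< → rest (suc k) (s≤s j<) (s≤s k<))
  out : (suc j < suc m × m′ ≡ suc m × bump (x (suc j)) (G (suc j)) ≡ (G′ (suc j) , nothing)) ⊎ (suc j ≡ suc m × m′ ≡ suc (suc m) × G′ (suc j) ≡ [ x (suc j) ]) →
    (G′ 0 ∷ applyUpTo (G′ ∘ suc) (pre m′) , suc j) ≡ (applyUpTo G′ m′ , suc j)
  out (inj₁ (_ , refl , _)) = refl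
  out (inj₂ (_ , refl , _)) = refl

addAt-column : ∀ v (G G′ : ℕ → List ℕ) m m′ j →
  (j < m × m′ ≡ m × G′ j ≡ G j ∷ʳ v) ⊎ (j ≡ m × m′ ≡ suc m × G′ j ≡ [ v ]) →
  (∀ k → k < m → k ≢ j → G′ k ≡ G k) →
  addAt v j (applyUpTo G m) ≡ applyUpTo G′ m′
addAt-column v G G′ zero m′ zero (inj₂ (_ , refl , e)) rest = cong (_∷ []) (sym e)
addAt-column v G G′ (suc m) m′ zero (inj₁ (_ , refl , e)) rest =
  cong₂ _∷_ (sym e) (sym (applyUpTo-cong m (λ k k< → rest (suc k) (s≤s k<) (λ ()))))
addAt-column v G G′ (suc m) m′ (suc j) (inj₁ (s≤s j< , refl , e)) rest = cong₂ _∷_ (sym (rest 0 (s≤s z≤n) (λ ())))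
  (addAt-column v (G ∘ suc) (G′ ∘ suc) m m j (inj₁ (j< , refl , e)) (λ k k< ne → rest (suc k) (s≤s k<) (λ e → ne (suc-injective e))))
addAt-column v G G′ (suc m) m′ (suc j) (inj₂ (refl , refl , e)) rest = cong₂ _∷_ (sym (rest 0 (s≤s z≤n) (λ ())))
  (addAt-column v (G ∘ suc) (G′ ∘ suc) m (suc m) j (inj₂ (refl , refl , e)) (λ k k< ne → rest (suc k) (s≤s k<) (λ e → ne (suc-injective e))))

module _ {n r c : ℕ} {Q : Tab} (s : Standard n r c Q) where
  private
    module R = Cells s
    module K = Cells (transposed s)

  standard-mono : ∀ {i j i′ j′} → i ≤ i′ → j ≤ j′ → i′ < r → j′ < c → Q i j ≤ Q i′ j′
  standard-mono {i} {j} {i′} {j′} i≤ j≤ i′< j′< = ≤-trans along down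
    where
    along : Q i j ≤ Q i j′
    along with m≤n⇒m<n∨m≡n j≤
    ... | inj₁ lt = <⇒≤ (R.row-strict (≤-<-trans i≤ i′<) lt j′<)
    ... | inj₂ refl = ≤-refl
    down : Q i j′ ≤ Q i′ j′
    down with m≤n⇒m<n∨m≡n i≤
    ... | inj₁ lt = <⇒≤ (K.row-strict j′< lt i′<)
    ... | inj₂ refl = ≤-refl

module Insertion {n r c : ℕ} {P Q : Tab} {y z : ℕ → ℕ} (0<r : 0 < r) (sP : Standard n r c P) (sQ : Standard n r c Q) (chart : Chart n r c P y z) where
  open Chart chart
  private
    module R = Cells sQ
    module PC = Cells (transposed sP)
    module PR = Cells sP

  crossing : ℕ → ℕ
  crossing t = Q (y t) (c ∸ suc (z t))

  -- Column a of the insertion tableau consists of the last cnt y t a entries of row a of Q.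
  insRow recRow : ℕ → ℕ → List ℕ
  insRow t k = applyUpTo (λ a → Q a (k + (c ∸ cnt y t a))) (cnt z t k)
  recRow t k = applyUpTo (λ a → P a k) (cnt z t k)

  module Step (t : ℕ) (t<n : t < n) where
    private
      a j m m′ : ℕ
      a = y t
      j = z t
      m = cnt y t 0
      m′ = cnt y (suc t) 0
      -- the entry that is inserted into row k
      x : ℕ → ℕ
      x k = Q a (k + (c ∸ suc j))
      f f′ : ℕ → ℕ → ℕ
      f k i = Q i (k + (c ∸ cnt y t i))
      f′ k i = Q i (k + (c ∸ cnt y (suc t) i))
      a< : a < r
      a< = row< t t<n
      j< : j < c
      j< = col< t t<n

      f′-at : ∀ k → f′ k a ≡ x k
      f′-at k = cong (λ l → Q a (k + (c ∸ l))) (trans (inc-same a (cnt y t)) (cong suc (row-count t t<n)))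
      f′-other : ∀ k {i} → i ≢ a → f′ k i ≡ f k i
      f′-other k ne = cong (λ l → Q _ (k + (c ∸ l))) (inc-other (cnt y t) ne)

      x-col : ∀ k → k ≤ j → k + (c ∸ suc j) < c
      x-col k k≤ = begin-strict
        k + (c ∸ suc j) <⟨ +-monoˡ-< (c ∸ suc j) (s≤s k≤) ⟩
        suc j + (c ∸ suc j) ≡⟨ m+[n∸m]≡n j< ⟩
        c ∎
        where open ≤-Reasoning

      -- Since P i j < P a j, row i already has more than j entries, so column i of the insertion
      -- tableau starts no further right in Q than column a will; Q increases in both directions.
      left : ∀ k → k ≤ j → ∀ i → i < a → f k i ≤ x k
      left k k≤ i i<a = standard-mono sQ (<⇒≤ i<a) (+-monoʳ-≤ k (∸-monoʳ-≤ c j<cnt)) a< (x-col k k≤)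
        where
        j<cnt : j < cnt y t i
        j<cnt = ≰⇒> λ le → <⇒≱ (row-above t i j (<-trans i<a a<) j< le)
          (s≤s⁻¹ (subst (P i j <_) (entry t t<n) (PC.row-strict j< i<a a<)))

      next-x : ∀ k → f k a ≡ x (suc k)
      next-x k = cong (Q a) (begin
        k + (c ∸ cnt y t a) ≡⟨ cong (λ l → k + (c ∸ l)) (row-count t t<n) ⟩
        k + (c ∸ j) ≡⟨ cong (k +_) (∸-suc j<) ⟩
        k + suc (c ∸ suc j) ≡⟨ +-suc k _ ⟩
        suc k + (c ∸ suc j) ∎)
        where
        open ≡-Reasoning
        ∸-suc : ∀ {j c} → j < c → c ∸ j ≡ suc (c ∸ suc j)
        ∸-suc {zero} (s≤s _) = refl
        ∸-suc {suc j} (s≤s lt) = ∸-suc lt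

      x-inc : ∀ k → k < j → x k < x (suc k)
      x-inc k k< = R.row-strict a< ≤-refl (x-col (suc k) k<)

      P< : ∀ k → k < j → P a k ≤ t
      P< k k< = s≤s⁻¹ (subst (P a k <_) (entry t t<n) (PR.row-strict a< k< j<))

      long : ∀ k → k < j → a < cnt z t k
      long k k< = ≰⇒> λ le → <⇒≱ (col-above t a k a< (<-trans k< j<) le) (P< k k<)

      height : ∀ k → k < j → k < m
      height k k< = ≰⇒> λ le → <⇒≱ (row-above t 0 k 0<r (<-trans k< j<) le) (≤-trans (standard-mono sP z≤n ≤-refl a< (<-trans k< j<)) (P< k k<))

      same-length : ∀ k → k ≢ j → cnt z (suc t) k ≡ cnt z t k
      same-length k ne = inc-other (cnt z t) ne

      end-length : cnt z t j ≡ a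
      end-length = col-count t t<n

      end-length′ : cnt z (suc t) j ≡ suc a
      end-length′ = trans (inc-same j (cnt z t)) (cong suc end-length)

      bumped : ∀ k → k < j → k < m × bump (x k) (insRow t k) ≡ (insRow (suc t) k , just (x (suc k)))
      bumped k k< = height k k< , (begin
        bump (x k) (insRow t k)
          ≡⟨ bump-replace (x k) (f k) (f′ k) (cnt z t k) a (long k k<) (left k (<⇒≤ k<))
               (subst (x k <_) (sym (next-x k)) (x-inc k k<)) (f′-at k) (λ i _ ne → f′-other k ne) ⟩
        (applyUpTo (f′ k) (cnt z t k) , just (f k a))
          ≡⟨ cong₂ (λ l v → applyUpTo (f′ k) l , just v) (sym (same-length k (<⇒≢ k<))) (next-x k) ⟩
        (insRow (suc t) k , just (x (suc k))) ∎)
        where open ≡-Reasoning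

      appended : insRow t j ∷ʳ x j ≡ insRow (suc t) j
      appended = begin
        insRow t j ∷ʳ x j ≡⟨ cong₂ (λ l v → applyUpTo (f j) l ∷ʳ v) end-length (sym (f′-at j)) ⟩
        applyUpTo (f j) a ∷ʳ f′ j a ≡⟨ cong (_∷ʳ f′ j a) (applyUpTo-cong a (λ i i< → sym (f′-other j (<⇒≢ i<)))) ⟩
        applyUpTo (f′ j) a ∷ʳ f′ j a ≡⟨ applyUpTo-∷ʳ (f′ j) a ⟩
        applyUpTo (f′ j) (suc a) ≡⟨ cong (applyUpTo (f′ j)) end-length′ ⟨
        insRow (suc t) j ∎
        where open ≡-Reasoning

      appended-rec : recRow (suc t) j ≡ recRow t j ∷ʳ suc t
      appended-rec = begin
        recRow (suc t) j ≡⟨ cong (applyUpTo (λ i → P i j)) end-length′ ⟩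
        applyUpTo (λ i → P i j) (suc a) ≡⟨ applyUpTo-∷ʳ (λ i → P i j) a ⟨
        applyUpTo (λ i → P i j) a ∷ʳ P a j ≡⟨ cong₂ (λ l v → applyUpTo (λ i → P i j) l ∷ʳ v) (sym end-length) (entry t t<n) ⟩
        recRow t j ∷ʳ suc t ∎
        where open ≡-Reasoning

      newRow : a ≡ 0 → insRow (suc t) j ≡ [ x j ]
      newRow e = trans (sym appended) (cong (λ l → applyUpTo (f j) l ∷ʳ x j) (trans end-length e))

      newRec : a ≡ 0 → recRow (suc t) j ≡ [ suc t ]
      newRec e = trans appended-rec (cong (λ l → applyUpTo (λ i → P i j) l ∷ʳ suc t) (trans end-length e))

      atEnd : (j < m × m′ ≡ m × bump (x j) (insRow t j) ≡ (insRow (suc t) j , nothing)) ⊎ (j ≡ m × m′ ≡ suc m × insRow (suc t) j ≡ [ x j ])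
      atEnd with a ≟ 0
      ... | yes a≡0 = inj₂ (trans (sym (row-count t t<n)) (cong (cnt y t) a≡0) , trans (cong (λ b → inc b (cnt y t) 0) a≡0) (inc-same 0 (cnt y t)) , newRow a≡0)
      ... | no a≢0 = inj₁ (j<m , inc-other (cnt y t) (λ e → a≢0 (sym e)) , trans
              (bump-append (x j) (f j) (cnt z t j) (λ i i< → left j ≤-refl i (subst (i <_) end-length i<)))
              (cong (_, nothing) appended))
        where
        j<m : j < m
        j<m = ≰⇒> λ le → <⇒≱ (row-above t 0 j 0<r j< le) (s≤s⁻¹ (subst (P 0 j <_) (entry t t<n) (PC.row-strict j< (n≢0⇒n>0 a≢0) a<)))

      recEnd : (j < m × m′ ≡ m × bump (x j) (insRow t j) ≡ (insRow (suc t) j , nothing)) ⊎ (j ≡ m × m′ ≡ suc m × insRow (suc t) j ≡ [ x j ]) →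
        (j < m × m′ ≡ m × recRow (suc t) j ≡ recRow t j ∷ʳ suc t) ⊎ (j ≡ m × m′ ≡ suc m × recRow (suc t) j ≡ [ suc t ])
      recEnd (inj₁ (p , q , _)) = inj₁ (p , q , appended-rec)
      recEnd (inj₂ (p , q , _)) with a ≟ 0
      ... | yes a≡0 = inj₂ (p , q , newRec a≡0)
      ... | no a≢0 = ⊥-elim (1+n≢n (trans (sym q) (inc-other (cnt y t) (λ e → a≢0 (sym e)))))

      -- Only column a changes, and the rows below the new box do not reach it.
      beyond : ∀ k → j < k → k < m → insRow (suc t) k ≡ insRow t k
      beyond k j<k k<m = trans (cong (applyUpTo (f′ k)) (same-length k (λ e → <⇒≢ j<k (sym e))))
        (applyUpTo-cong (cnt z t k) (λ i i< → f′-other k (λ { refl → <⇒≱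
          (subst (_< P a k) (entry t t<n) (PR.row-strict a< j<k k<c))
          (m≤n⇒m≤1+n (col-below t a k a< k<c i<)) })))
        where
        k<c : k < c
        k<c = <-≤-trans k<m (row-cnt≤ t 0 0<r)

    insert : insertP (crossing t) (applyUpTo (insRow t) m) ≡ (applyUpTo (insRow (suc t)) m′ , z t)
    insert = insertP-column x (insRow t) (insRow (suc t)) m m′ j bumped atEnd beyond

    record-step : addAt (suc t) (z t) (applyUpTo (recRow t) m) ≡ applyUpTo (recRow (suc t)) m′
    record-step = addAt-column (suc t) (recRow t) (recRow (suc t)) m m′ j (recEnd atEnd)
      (λ k k< ne → cong (applyUpTo (λ i → P i k)) (same-length k ne))

  tableaux : ℕ → List (List ℕ) × List (List ℕ)
  tableaux t = applyUpTo (insRow t) (cnt y t 0) , applyUpTo (recRow t) (cnt y t 0)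

  RSgo-crossing : ∀ d t → t + d ≡ n → RSgo (suc t) (applyUpTo (λ k → crossing (t + k)) d) (tableaux t) ≡ tableaux n
  RSgo-crossing zero t e = cong tableaux (trans (sym (+-identityʳ t)) e)
  RSgo-crossing (suc d) t e = begin
    RSgo (suc t) (crossing (t + 0) ∷ applyUpTo (λ k → crossing (t + suc k)) d) (tableaux t)
      ≡⟨ cong₂ (λ v l → RSgo (suc t) (v ∷ l) (tableaux t)) (cong crossing (+-identityʳ t)) (applyUpTo-cong d (λ k _ → cong crossing (+-suc t k))) ⟩
    RSgo (suc t) (crossing t ∷ applyUpTo (λ k → crossing (suc t + k)) d) (tableaux t)
      ≡⟨ cong (RSgo (suc (suc t)) (applyUpTo (λ k → crossing (suc t + k)) d))
           (trans (cong (λ res → proj₁ res , addAt (suc t) (proj₂ res) (proj₂ (tableaux t))) (Step.insert t t<n))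
             (cong (applyUpTo (insRow (suc t)) (cnt y (suc t) 0) ,_) (Step.record-step t t<n))) ⟩
    RSgo (suc (suc t)) (applyUpTo (λ k → crossing (suc t + k)) d) (tableaux (suc t))
      ≡⟨ RSgo-crossing d (suc t) (trans (sym (+-suc t d)) e) ⟩
    tableaux n ∎
    where
    open ≡-Reasoning
    t<n : t < n
    t<n = ≤-trans (s≤s (m≤m+n t d)) (≤-reflexive (trans (sym (+-suc t d)) e))

  private
    full-row : ∀ i → i < r → cnt y n i ≡ c
    full-row i i< = ≤-antisym (row-cnt≤ n i i<) (≮⇒≥ λ lt → <⇒≱ (row-above n i _ i< lt ≤-refl) (Standard.bounded sP i _ i< lt))
    full-col : ∀ j → j < c → cnt z n j ≡ r
    full-col j j< = ≤-antisym (col-cnt≤ n j j<) (≮⇒≥ λ lt → <⇒≱ (col-above n _ j lt j< ≤-refl) (Standard.bounded sP _ j lt j<))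

  applyUpTo-transpose : ∀ r c (T : Tab) → applyUpTo (λ k → applyUpTo (λ i → T i k) r) c ≡ transposeRows r c T
  applyUpTo-transpose r c T = sym (trans (map-upTo _ c) (applyUpTo-cong c (λ k _ → map-upTo (λ i → T i k) r)))

  -- At time n all row counts are c, so the offsets in `insRow` vanish and column a is the whole row
  -- a of Q.
  RS-crossing : RS (applyUpTo crossing n) ≡ (transposeRows r c Q , transposeRows r c P)
  RS-crossing = trans (RSgo-crossing n 0 refl) (cong₂ _,_
    (trans (trans (cong (applyUpTo (insRow n)) (full-row 0 0<r)) (applyUpTo-cong c λ k k< →
      trans (cong (applyUpTo _) (full-col k k<)) (applyUpTo-cong r λ i i< → cong (Q i) (trans (cong (λ l → k + (c ∸ l)) (full-row i i<)) (trans (cong (k +_) (n∸n≡0 c)) (+-identityʳ k))))))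
      (applyUpTo-transpose r c Q))
    (trans (trans (cong (applyUpTo (recRow n)) (full-row 0 0<r)) (applyUpTo-cong c λ k k< → cong (applyUpTo _) (full-col k k<)))
      (applyUpTo-transpose r c P)))

-- The crossing word is a permutation

applyUpTo-reversed : ∀ {A : Set} (g : ℕ → A) c → applyUpTo (λ j → g (c ∸ suc j)) c ↭ applyUpTo g c
applyUpTo-reversed g zero = ↭-refl
applyUpTo-reversed g (suc c) = begin
  g c ∷ applyUpTo (λ j → g (c ∸ suc j)) c <⟨ applyUpTo-reversed g c ⟩
  g c ∷ applyUpTo g c ↭⟨ ∷↭∷ʳ (g c) (applyUpTo g c) ⟩
  applyUpTo g c ∷ʳ g c ≡⟨ applyUpTo-∷ʳ g c ⟩
  applyUpTo g (suc c) ∎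
  where open PermutationReasoning

concatMap-↭ : ∀ {A B : Set} (f g : A → List B) xs → (∀ x → f x ↭ g x) → concatMap f xs ↭ concatMap g xs
concatMap-↭ f g [] e = ↭-refl
concatMap-↭ f g (x ∷ xs) e = ++⁺ (e x) (concatMap-↭ f g xs e)

map-cong-∈ : ∀ {A B : Set} {f g : A → B} xs → (∀ {x} → x ∈ xs → f x ≡ g x) → map f xs ≡ map g xs
map-cong-∈ [] e = refl
map-cong-∈ (x ∷ xs) e = cong₂ _∷_ (e (here refl)) (map-cong-∈ xs (e ∘ there))

entries-by-rows : ∀ r c T → entries r c T ≡ concatMap (λ i → applyUpTo (T i) c) (upTo r)
entries-by-rows r c T = trans (map-concatMap (λ p → T (proj₁ p) (proj₂ p)) (λ i → map (λ j → i , j) (upTo c)) (upTo r))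
  (concatMap-cong (λ i → trans (sym (map-∘ (upTo c))) (map-upTo (T i) c)) (upTo r))

entries-reversed : ∀ r c T → entries r c (λ i j → T i (c ∸ suc j)) ↭ entries r c T
entries-reversed r c T = begin
  entries r c (λ i j → T i (c ∸ suc j)) ≡⟨ entries-by-rows r c _ ⟩
  concatMap (λ i → applyUpTo (λ j → T i (c ∸ suc j)) c) (upTo r) ↭⟨ concatMap-↭ _ _ (upTo r) (λ i → applyUpTo-reversed (T i) c) ⟩
  concatMap (λ i → applyUpTo (T i) c) (upTo r) ≡⟨ entries-by-rows r c T ⟨
  entries r c T ∎
  where open PermutationReasoning

module _ {r c : ℕ} {P Q : Tab} (0<r : 0 < r) (sytP : IsSYT r c P) (sytQ : IsSYT r c Q) where
  private
    sP = syt-standard sytP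
    module C = Cells sP
    open Insertion 0<r sP (syt-standard sytQ) (standard-chart sP)

  -- Read along the cells of P instead of along time, the crossing word is Q with every row
  -- reversed.
  crossing-↭ : applyUpTo crossing (r * c) ↭ oneTo (r * c)
  crossing-↭ = begin
    applyUpTo crossing (r * c) ≡⟨ map-upTo crossing (r * c) ⟨
    map crossing (upTo (r * c)) ≡⟨ map-∘ {g = crossing ∘ pred} {f = suc} (upTo (r * c)) ⟩
    map (crossing ∘ pred) (oneTo (r * c)) ↭⟨ map⁺ (crossing ∘ pred) (IsSYT.perm sytP) ⟨
    map (crossing ∘ pred) (entries r c P) ≡⟨ map-∘ (cells r c) ⟨
    map (λ p → crossing (pred (P (proj₁ p) (proj₂ p)))) (cells r c) ≡⟨ map-cong-∈ (cells r c) at ⟩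
    entries r c (λ i j → Q i (c ∸ suc j)) ↭⟨ entries-reversed r c Q ⟩
    entries r c Q ↭⟨ IsSYT.perm sytQ ⟩
    oneTo (r * c) ∎
    where
    open PermutationReasoning
    at : ∀ {p} → p ∈ cells r c → crossing (pred (P (proj₁ p) (proj₂ p))) ≡ Q (proj₁ p) (c ∸ suc (proj₂ p))
    at {i , j} p∈ with ∈-cells⁻ r c p∈
    ... | i< , j< with C.location (pred (P i j)) i< j< (sym (suc-pred (P i j) {{>-nonZero (Standard.positive sP i j i< j<)}}))
    ... | e₁ , e₂ = cong₂ (λ a b → Q a (c ∸ suc b)) e₁ e₂

-- The path of the hole in a filling

≡ᵇ-refl : ∀ n → (n ≡ᵇ n) ≡ true
≡ᵇ-refl zero = refl
≡ᵇ-refl (suc n) = ≡ᵇ-refl n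

≡ᵇ-false : ∀ {m n} → m ≢ n → (m ≡ᵇ n) ≡ false
≡ᵇ-false {m} {n} ne with m ≡ᵇ n in eq
... | false = refl
... | true = ⊥-elim (ne (≡ᵇ⇒≡ m n (subst T (sym eq) tt)))

upd-same : ∀ U i j v → upd U i j v i j ≡ v
upd-same U i j v rewrite ≡ᵇ-refl i | ≡ᵇ-refl j = refl

upd-other : ∀ U i j v {a b} → ¬ (a ≡ i × b ≡ j) → upd U i j v a b ≡ U a b
upd-other U i j v {a} {b} ne with a ≟ i | b ≟ j
... | yes e | yes e′ = ⊥-elim (ne (e , e′))
... | no a≢ | _ rewrite ≡ᵇ-false a≢ = refl
... | yes refl | no b≢ rewrite ≡ᵇ-refl a | ≡ᵇ-false b≢ = refl

pick-here : ∀ k v ms → pick k ((k , v) ∷ ms) ≡ v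
pick-here k v ms rewrite ≡ᵇ-refl k = refl

pick-there : ∀ {k a} v ms → a ≢ k → pick k ((a , v) ∷ ms) ≡ pick k ms
pick-there v ms ne rewrite ≡ᵇ-false ne = refl

module _ {R c : ℕ} where

  slide-down : ∀ f U i j → suc i < R → (suc j < c → U (suc i) j < U i (suc j)) →
    slide R c (suc f) U i j ≡
      (let res = slide R c f (upd U i j (U (suc i) j)) (suc i) j in proj₁ res , (i , U (suc i) j) ∷ proj₂ res)
  slide-down f U i j i< lt rewrite <ᵇ-true i< with suc j <? c
  ... | yes j< rewrite <ᵇ-true j< | <ᵇ-true (lt j<) = refl
  ... | no j≮ rewrite <ᵇ-false (≮⇒≥ j≮) = refl

  slide-right : ∀ f U i j → suc j < c → (suc i < R → U i (suc j) ≤ U (suc i) j) →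
    slide R c (suc f) U i j ≡ slide R c f (upd U i j (U i (suc j))) i (suc j)
  slide-right f U i j j< le with suc i <? R
  ... | yes i< rewrite <ᵇ-true i< | <ᵇ-true j< | <ᵇ-false (le i<) = refl
  ... | no i≮ rewrite <ᵇ-false (≮⇒≥ i≮) | <ᵇ-true j< = refl

  slide-stop : ∀ f U i j → R ≤ suc i → c ≤ suc j → slide R c f U i j ≡ (U , [])
  slide-stop zero U i j _ _ = refl
  slide-stop (suc f) U i j i≥ j≥ rewrite <ᵇ-false i≥ | <ᵇ-false j≥ = refl

  -- The fuel always exceeds the remaining distance to the corner.
  Fuel : ℕ → ℕ → ℕ → Set
  Fuel f i j = f + (i + j) ≡ R + c

  fuel-suc : ∀ {f i j} → Fuel f i j → i < R → j < c → ∃ λ f′ → f ≡ suc f′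
  fuel-suc {zero} e i< j< = ⊥-elim (<⇒≢ (+-mono-< i< j<) e)
  fuel-suc {suc f} _ _ _ = f , refl

  fuel-down : ∀ {f i j} → Fuel (suc f) i j → Fuel f (suc i) j
  fuel-down {f} e = trans (+-suc f _) e

  fuel-right : ∀ {f i j} → Fuel (suc f) i j → Fuel f i (suc j)
  fuel-right {f} {i} {j} e = trans (cong (f +_) (+-suc i j)) (trans (+-suc f _) e)

  NotAt : ℕ → ℕ → ℕ → ℕ → Set
  NotAt i j a b = ¬ (a ≡ i × b ≡ j)

  SouthEast : ℕ → ℕ → ℕ → ℕ → Set
  SouthEast i j a b = i ≤ a × j ≤ b

  -- Once the hole is below Q, its path among the added entries need not be known, only that they
  -- stay there and exceed B. The corner is left out because it keeps a stale value until `gro`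
  -- overwrites it.
  record LargeTail (B i j : ℕ) (U U′ : Tab) : Set where
    field
      unchanged : ∀ a b → ¬ SouthEast i j a b → U′ a b ≡ U a b
      large : ∀ a b → a < R → b < c → SouthEast i j a b → NotAt (R ∸ 1) (c ∸ 1) a b → B < U′ a b
  open LargeTail

  data Move (U : Tab) (i j : ℕ) : Set where
    down : suc i < R → (suc j < c → U (suc i) j < U i (suc j)) → Move U i j
    right : suc j < c → (suc i < R → U i (suc j) ≤ U (suc i) j) → Move U i j
    stop : R ≤ suc i → c ≤ suc j → Move U i j

  move : ∀ U i j → Move U i j
  move U i j with suc i <? R | suc j <? c
  ... | no i≮ | no j≮ = stop (≮⇒≥ i≮) (≮⇒≥ j≮)
  ... | no i≮ | yes j< = right j< (λ i< → ⊥-elim (i≮ i<))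
  ... | yes i< | no j≮ = down i< (λ j< → ⊥-elim (j≮ j<))
  ... | yes i< | yes j< with U (suc i) j <? U i (suc j)
  ... | yes lt = down i< (λ _ → lt)
  ... | no nlt = right j< (λ _ → ≮⇒≥ nlt)

  module _ {B i j i₁ j₁ : ℕ} {U : Tab} (se₁ : SouthEast i j i₁ j₁) (ne₁ : NotAt i j i₁ j₁) (i₁< : i₁ < R) (j₁< : j₁ < c)
    (big : ∀ a b → a < R → b < c → SouthEast i j a b → NotAt i j a b → B < U a b) where
    private
      U₁ = upd U i j (U i₁ j₁)
      within : ∀ {a b} → SouthEast i₁ j₁ a b → SouthEast i j a b
      within (p , q) = ≤-trans (proj₁ se₁) p , ≤-trans (proj₂ se₁) q
      apart : ∀ {a b} → SouthEast i₁ j₁ a b → NotAt i j a b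
      apart (p , q) (refl , refl) = ne₁ (≤-antisym p (proj₁ se₁) , ≤-antisym q (proj₂ se₁))

    large-step-hyp : ∀ a b → a < R → b < c → SouthEast i₁ j₁ a b → NotAt i₁ j₁ a b → B < U₁ a b
    large-step-hyp a b a< b< se ne = subst (B <_) (sym (upd-other U i j _ (apart se))) (big a b a< b< (within se) (apart se))

    large-step : ∀ {U′} → LargeTail B i₁ j₁ U₁ U′ → LargeTail B i j U U′
    large-step {U′} tail = record
      { unchanged = λ a b nse → trans (unchanged tail a b (λ se → nse (within se))) (upd-other U i j _ λ { (refl , refl) → nse (≤-refl , ≤-refl) })
      ; large = lg }
      where
      lg : ∀ a b → a < R → b < c → SouthEast i j a b → NotAt (R ∸ 1) (c ∸ 1) a b → B < U′ a b
      lg a b a< b< se ne with (i₁ ≤? a) ×-dec (j₁ ≤? b)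
      ... | yes se′ = large tail a b a< b< se′ ne
      ... | no nse = subst (B <_) (sym (unchanged tail a b nse)) at
        where
        at : B < U₁ a b
        at with (a ≟ i) ×-dec (b ≟ j)
        ... | yes (refl , refl) = subst (B <_) (sym (upd-same U i j _)) (big i₁ j₁ i₁< j₁< se₁ ne₁)
        ... | no nat = subst (B <_) (sym (upd-other U i j _ nat)) (big a b a< b< se nat)

  corner : ∀ {i n} → i < n → n ≤ suc i → i ≡ n ∸ 1
  corner i< n≤ = sym (cong pred (≤-antisym n≤ i<))

  slide-large : ∀ B f U i j → Fuel f i j → i < R → j < c →
    (∀ a b → a < R → b < c → SouthEast i j a b → NotAt i j a b → B < U a b) →
    LargeTail B i j U (proj₁ (slide R c f U i j))
  slide-large B zero U i j fuel i< j< big = ⊥-elim (<⇒≢ (+-mono-< i< j<) fuel)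
  slide-large B (suc f) U i j fuel i< j< big with move U i j
  ... | stop i≥ j≥ rewrite slide-stop (suc f) U i j i≥ j≥ = record
    { unchanged = λ _ _ _ → refl
    ; large = λ a b a< b< se ne → big a b a< b< se λ { (refl , refl) → ne (corner i< i≥ , corner j< j≥) } }
  ... | down i₁< lt rewrite slide-down f U i j i₁< lt =
    large-step se ne i₁< j< big (slide-large B f _ (suc i) j (fuel-down {f} {i} {j} fuel) i₁< j< (large-step-hyp se ne i₁< j< big))
    where
    se : SouthEast i j (suc i) j
    se = n≤1+n i , ≤-refl
    ne : NotAt i j (suc i) j
    ne (e , _) = 1+n≢n e
  ... | right j₁< le rewrite slide-right f U i j j₁< le =
    large-step se ne i< j₁< big (slide-large B f _ i (suc j) (fuel-right {f} {i} {j} fuel) i< j₁< (large-step-hyp se ne i< j₁< big))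
    where
    se : SouthEast i j i (suc j)
    se = ≤-refl , n≤1+n j
    ne : NotAt i j i (suc j)
    ne (_ , e) = 1+n≢n e

  InColumn : ℕ → ℕ → ℕ → ℕ → ℕ → Set
  InColumn i j ℓ a b = b ≡ j × i ≤ a × a < i + ℓ

  record Descent (ℓ : ℕ) (U : Tab) (i j : ℕ) (res : Tab × List (ℕ × ℕ)) : Set where
    field
      fuel : ℕ
      tab : Tab
      fuel-ok : Fuel fuel (i + ℓ) j
      shifted : ∀ a → a < ℓ → tab (i + a) j ≡ U (suc (i + a)) j
      unchanged : ∀ a b → ¬ InColumn i j ℓ a b → tab a b ≡ U a b
      continues : proj₁ res ≡ proj₁ (slide R c fuel tab (i + ℓ) j)
      moves : ∀ a → a < ℓ → pick (i + a) (proj₂ res) ≡ U (suc (i + a)) j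

  descent : ∀ ℓ f U i j → Fuel f i j → i + ℓ < R → j < c →
    (∀ a → a < ℓ → suc j < c → U (suc (i + a)) j < U (i + a) (suc j)) → Descent ℓ U i j (slide R c f U i j)
  descent zero f U i j fuel i< j< lt = record
    { fuel = f ; tab = U ; fuel-ok = trans (cong (λ z → f + (z + j)) (+-identityʳ i)) fuel
    ; shifted = λ _ () ; unchanged = λ _ _ _ → refl
    ; continues = cong (λ z → proj₁ (slide R c f U z j)) (sym (+-identityʳ i)) ; moves = λ _ () }
  descent (suc ℓ) zero U i j fuel i< j< lt = ⊥-elim (<⇒≢ (+-mono-< (≤-<-trans (m≤m+n i (suc ℓ)) i<) j<) fuel)
  descent (suc ℓ) (suc f) U i j fuel i< j< lt
    rewrite slide-down f U i j (≤-<-trans (subst (_≤ i + suc ℓ) (+-comm i 1) (+-monoʳ-≤ i (s≤s z≤n))) i<)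
              (λ sj< → subst (λ z → U (suc z) j < U z (suc j)) (+-identityʳ i) (lt 0 (s≤s z≤n) sj<)) = record
    { fuel = D.fuel
    ; tab = D.tab
    ; fuel-ok = subst (λ z → Fuel D.fuel z j) (sym (+-suc i ℓ)) D.fuel-ok
    ; shifted = shifted′
    ; unchanged = λ a b nc → trans (D.unchanged a b (λ { (e , p , q) → nc (e , <⇒≤ p , subst (a <_) (sym (+-suc i ℓ)) q) }))
        (upd-other U i j v λ { (refl , refl) → nc (refl , ≤-refl , subst (_≤ a + suc ℓ) (+-comm a 1) (+-monoʳ-≤ a (s≤s z≤n))) })
    ; continues = trans D.continues (cong (λ z → proj₁ (slide R c D.fuel D.tab z j)) (sym (+-suc i ℓ)))
    ; moves = moves′ }
    where
    v = U (suc i) j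
    U₁ = upd U i j v
    lower : ∀ a b → i < a → U₁ a b ≡ U a b
    lower a b i<a = upd-other U i j v (λ { (refl , _) → <-irrefl refl i<a })
    descended : Descent ℓ U₁ (suc i) j (slide R c f U₁ (suc i) j)
    descended = descent ℓ f U₁ (suc i) j (fuel-down {f} {i} {j} fuel) (subst (_< R) (+-suc i ℓ) i<) j<
      (λ a a< sj< → subst₂ _<_ (sym (lower _ _ (s≤s (≤-trans (m≤m+n i a) (n≤1+n _))))) (sym (lower _ _ (s≤s (m≤m+n i a))))
        (subst (λ z → U (suc z) j < U z (suc j)) (+-suc i a) (lt (suc a) (s≤s a<) sj<)))
    module D = Descent descended
    shifted′ : ∀ a → a < suc ℓ → D.tab (i + a) j ≡ U (suc (i + a)) j
    shifted′ zero _ = subst (λ z → D.tab z j ≡ U (suc z) j) (sym (+-identityʳ i))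
      (trans (D.unchanged i j (λ { (_ , p , _) → 1+n≰n p })) (upd-same U i j v))
    shifted′ (suc a) (s≤s a<) = subst (λ z → D.tab z j ≡ U (suc z) j) (sym (+-suc i a))
      (trans (D.shifted a a<) (lower _ _ (s≤s (≤-trans (m≤m+n i a) (n≤1+n _)))))
    res = slide R c f U₁ (suc i) j
    moves′ : ∀ a → a < suc ℓ → pick (i + a) ((i , v) ∷ proj₂ res) ≡ U (suc (i + a)) j
    moves′ zero _ = subst (λ z → pick z ((i , v) ∷ proj₂ res) ≡ U (suc z) j) (sym (+-identityʳ i)) (pick-here i v (proj₂ res))
    moves′ (suc a) (s≤s a<) = subst (λ z → pick z ((i , v) ∷ proj₂ res) ≡ U (suc z) j) (sym (+-suc i a))
      (trans (pick-there v (proj₂ res) (<⇒≢ (s≤s (m≤m+n i a)))) (trans (D.moves a a<) (lower _ _ (s≤s (≤-trans (m≤m+n i a) (n≤1+n _))))))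

module _ {R c r : ℕ} where

  -- The remaining fuel is part of the data because an entry that is not next to the hole costs no
  -- step of `slide`. Moves among the entries of P fill rows above row r - 1, hence the restriction
  -- on k in `picks`.
  record Advanced (h j h′ j′ p′ q′ v : ℕ) (U : Tab) (res : Tab × List (ℕ × ℕ)) : Set where
    field
      fuel : ℕ
      tab : Tab
      fuel-ok : Fuel {R} {c} fuel h′ j′
      moved : tab p′ q′ ≡ v
      unchanged : ∀ a b → NotAt {R} {c} h j a b → tab a b ≡ U a b
      result : proj₁ res ≡ proj₁ (slide R c fuel tab h′ j′)
      picks : ∀ k → r ≤ suc k → pick k (proj₂ res) ≡ pick k (proj₂ (slide R c fuel tab h′ j′))

  -- The entry v is smaller than everything beyond it, so if it lies below or to the right of the
  -- hole, `slide` chooses it; otherwise the hole waits. `Swap` is the case below, p = h the case to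
  -- the right.
  advance : ∀ {h p p′ h′ X v f U} → r < R → h < r → p < r → inc h X p < c → (∀ a → suc a < r → X (suc a) ≤ X a) → (∀ a → r ≤ a → X a ≡ 0) →
    Fuel {R} {c} f h (X h) → X h < c → U p (inc h X p) ≡ v →
    (∀ a b → a < R → b < c → inc p (inc h X) a ≤ b → v < U a b) →
    Local r X h p p′ h′ →
    Advanced h (X h) h′ (inc p′ X h′) p′ (X p′) v U (slide R c f U h (X h))
  advance {f = zero} r<R h<r _ _ _ _ fuel col< _ _ _ = ⊥-elim (<⇒≢ (+-mono-< (<-trans h<r r<R) col<) fuel)
  advance {h} {p} {X = X} {v} {suc f} {U} r<R h<r p<r q< dec none fuel col< at out (swapped (refl , _ , e))
    rewrite slide-down f U h (X h) (<-trans p<r r<R)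
      (λ sj< → subst (_< U h (suc (X h))) (trans (sym at) (cong (U p) (trans (inc-other X 1+n≢n) (sym e))))
        (out h (suc (X h)) (<-trans h<r r<R) sj< (≤-reflexive (trans (inc-other {suc h} {h} (inc h X) (λ e → 1+n≢n (sym e))) (inc-same h X))))) = record
    { fuel = f ; tab = upd U h (X h) (U p (X h))
    ; fuel-ok = subst (Fuel {R} {c} f p) (sym at-p) (fuel-down {R} {c} {f} {h} {X h} fuel)
    ; moved = trans (upd-same U h (X h) _) v≡
    ; unchanged = λ a b na → upd-other U h (X h) _ na
    ; result = cong (λ z → proj₁ (slide R c f (upd U h (X h) (U p (X h))) p z)) (sym at-p)
    ; picks = λ k r≤ → trans (pick-there {k} {h} (U p (X h)) (proj₂ (slide R c f (upd U h (X h) (U p (X h))) p (X h))) (λ { refl → <⇒≱ p<r r≤ })) (cong (λ z → pick k (proj₂ (slide R c f (upd U h (X h) (U p (X h))) p z))) (sym at-p)) }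
    where
    at-p : inc h X p ≡ X h
    at-p = trans (inc-other X 1+n≢n) (sym e)
    v≡ : U p (X h) ≡ v
    v≡ = trans (cong (U p) (sym at-p)) at
  advance {h} {p} {X = X} {v} {suc f} {U} r<R h<r p<r q< dec none fuel col< at out (passed ¬s) = split (p ≟ h)
    where
    split : Dec (p ≡ h) → Advanced h (X h) h (inc p X h) p (X p) v U (slide R c (suc f) U h (X h))
    split (no p≢h) = record
      { fuel = suc f ; tab = U
      ; fuel-ok = subst (Fuel {R} {c} (suc f) h) (sym stay) fuel
      ; moved = trans (cong (U p) (sym (inc-other X p≢h))) at
      ; unchanged = λ _ _ _ → refl
      ; result = cong (λ z → proj₁ (slide R c (suc f) U h z)) (sym stay)
      ; picks = λ k _ → cong (λ z → pick k (proj₂ (slide R c (suc f) U h z))) (sym stay) }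
      where
      stay : inc p X h ≡ X h
      stay = inc-other X (λ e → p≢h (sym e))
    split (yes refl) = record
      { fuel = f ; tab = U₁
      ; fuel-ok = subst (Fuel {R} {c} f h) (sym (inc-same h X)) (fuel-right {R} {c} {f} {h} {X h} fuel)
      ; moved = trans (upd-same U h (X h) _) v≡
      ; unchanged = λ a b na → upd-other U h (X h) _ na
      ; result = trans (cong proj₁ moved-right) (cong (λ z → proj₁ (slide R c f U₁ h z)) (sym (inc-same h X)))
      ; picks = λ k _ → trans (cong (λ z → pick k (proj₂ z)) moved-right) (cong (λ z → pick k (proj₂ (slide R c f U₁ h z))) (sym (inc-same h X))) }
      where
      U₁ = upd U h (X h) (U h (suc (X h)))
      v≡ : U h (suc (X h)) ≡ v
      v≡ = trans (cong (U h) (sym (inc-same h X))) at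
      below : X (suc h) ≤ X h
      below with suc h <? r
      ... | yes lt = dec h lt
      ... | no nlt = ≤-trans (≤-reflexive (none (suc h) (≮⇒≥ nlt))) z≤n
      moved-right : slide R c (suc f) U h (X h) ≡ slide R c f U₁ h (suc (X h))
      moved-right = slide-right f U h (X h) (subst (_< c) (inc-same h X) q<)
        (λ i< → <⇒≤ (subst (_< U (suc h) (X h)) (sym v≡) (out (suc h) (X h) i< col< (≤-trans (≤-reflexive (trans (inc-other (inc h X) 1+n≢n) (inc-other X 1+n≢n))) below))))

-- Local recursions made accessible, and counts of letters

promoted : ℕ → ℕ → ℕ → Tab → ℕ
promoted i R c T = residue (R * c) (pick (i ∸ 1) (proj₂ (gro R c T)))

-- The function local to prom has no name outside; unification in promGo-found supplies it.
mutual
  promGo : (i R c : ℕ) (T : Tab) → ℕ → Tab → List ℕ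
  promGo i R c T k T′ = _

  promGo-found : ∀ i R c T → prom i R c T ≡ prom i R c T
  promGo-found i R c T with R * c
  ... | zero = refl
  ... | suc m with proj₁ (gro R c T)
  ... | T₁ = cong (λ xs → promoted i R c T ∷ xs) {x = promGo i R c T m T₁} refl

cnt-mono : ∀ w {s t} k → s ≤ t → cnt w s k ≤ cnt w t k
cnt-mono w {s} {t} k s≤t = go t s≤t
  where
  go : ∀ t → s ≤ t → cnt w s k ≤ cnt w t k
  go t s≤t with m≤n⇒m<n∨m≡n s≤t
  ... | inj₂ refl = ≤-refl
  go (suc t) _ | inj₁ (s≤s s≤t) = ≤-trans (go t s≤t) (≤-inc (w t) (cnt w t) k)

cnt-< : ∀ w {s t} → s < t → cnt w s (w s) < cnt w t (w s)
cnt-< w {s} {t} s<t = subst (_≤ cnt w t (w s)) (inc-same (w s) (cnt w s)) (cnt-mono w (w s) s<t)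

cnt-hit : ∀ w d {a b} → b < cnt w d a → ∃ λ s → s < d × w s ≡ a × cnt w s a ≡ b
cnt-hit w (suc d) {a} {b} lt with a ≟ w d
... | no _ = let (s , s< , e , e′) = cnt-hit w d lt in s , m<n⇒m<1+n s< , e , e′
... | yes refl with m≤n⇒m<n∨m≡n (s≤s⁻¹ lt)
... | inj₂ e = d , ≤-refl , refl , sym e
... | inj₁ lt′ = let (s , s< , e , e′) = cnt-hit w d lt′ in s , m<n⇒m<1+n s< , e , e′

cnt-none : ∀ w {q a} t → (∀ s → s < t → w s < q) → q ≤ a → cnt w t a ≡ 0
cnt-none w zero _ _ = refl
cnt-none w (suc t) lt q≤a = trans (inc-other (cnt w t) (λ { refl → <⇒≱ (lt t ≤-refl) q≤a })) (cnt-none w t (λ s s< → lt s (m<n⇒m<1+n s<)) q≤a)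

hole-letter : ∀ q w t → (∀ s → s ≤ t → w s < q) → hole q w t < q
hole-letter q w zero lt = lt 0 z≤n
hole-letter q w (suc t) lt with swaps? q w t (hole q w t)
... | yes _ = lt (suc t) ≤-refl
... | no _ = hole-letter q w t (λ s s≤ → lt s (m≤n⇒m≤1+n s≤))

slideWord-letter : ∀ q w t → (∀ s → s ≤ suc t → w s < q) → slideWord q w t < q
slideWord-letter q w t lt with swaps? q w t (hole q w t)
... | yes _ = hole-letter q w t (λ s s≤ → lt s (m≤n⇒m≤1+n s≤))
... | no _ = lt (suc t) ≤-refl

mutual
  -- The recursion local to `argmin`, named by unification in the same way as `promGo`.
  argminGo : (R c : ℕ) (T : Tab) → List (ℕ × ℕ) → ℕ × ℕ
  argminGo R c T ps = _

  argminGo-found : ∀ R c T → argmin R c T ≡ argmin R c T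
  argminGo-found R c T with cells R c
  ... | ps = refl {x = argminGo R c T ps}

argminGo-∈ : ∀ R c T p ps → argminGo R c T (p ∷ ps) ∈ p ∷ ps
argminGo-∈ R c T p [] = here refl
argminGo-∈ R c T p (p′ ∷ ps)
  with T (proj₁ p) (proj₂ p) <ᵇ T (proj₁ (argminGo R c T (p′ ∷ ps))) (proj₂ (argminGo R c T (p′ ∷ ps)))
... | true = here refl
... | false = there (argminGo-∈ R c T p′ ps)

argminGo-least : ∀ R c T o ps → o ∈ ps → (∀ {x} → x ∈ ps → x ≡ o ⊎ T (proj₁ o) (proj₂ o) < T (proj₁ x) (proj₂ x)) →
  argminGo R c T ps ≡ o
argminGo-least R c T o (p ∷ []) (here refl) _ = refl
argminGo-least R c T o (p ∷ p′ ∷ ps) (here refl) least with least (there (argminGo-∈ R c T p′ ps))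
... | inj₂ lt rewrite <ᵇ-true lt = refl
... | inj₁ e rewrite e | <ᵇ-false (≤-refl {T (proj₁ o) (proj₂ o)}) = refl
argminGo-least R c T o (p ∷ p′ ∷ ps) (there o∈) least
  rewrite argminGo-least R c T o (p′ ∷ ps) o∈ (λ x∈ → least (there x∈)) with least (here refl)
... | inj₂ lt rewrite <ᵇ-false (<⇒≤ lt) = refl
... | inj₁ refl rewrite <ᵇ-false (≤-refl {T (proj₁ o) (proj₂ o)}) = refl

argmin-origin : ∀ R c T → 0 < R → 0 < c → (∀ a b → a < R → b < c → ¬ (a ≡ 0 × b ≡ 0) → T 0 0 < T a b) → argmin R c T ≡ (0 , 0)
argmin-origin R c T 0<R 0<c least = argminGo-least R c T (0 , 0) (cells R c) (∈-cells⁺ 0<R 0<c) dichotomy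
  where
  dichotomy : ∀ {x} → x ∈ cells R c → x ≡ (0 , 0) ⊎ T 0 0 < T (proj₁ x) (proj₂ x)
  dichotomy {a , b} x∈ with (a ≟ 0) ×-dec (b ≟ 0)
  ... | yes (refl , refl) = inj₁ refl
  ... | no ne = let (a< , b<) = ∈-cells⁻ R c x∈ in inj₂ (least a b a< b< ne)

∸-involutive : ∀ {j c} → j < c → c ∸ suc (c ∸ suc j) ≡ j
∸-involutive {j} {suc c} (s≤s j≤c) = m∸[m∸n]≡n j≤c

-- The tableau after i promotions

module Growth {r c : ℕ} {P Q : Tab} {y z : ℕ → ℕ} (0<r : 0 < r) (0<c : 0 < c) (sP : Standard (r * c) r c P) (sQ : Standard (r * c) r c Q)
  (chart : Chart (r * c) r c P y z) (rect : RectangularWord r c y) where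

  n R : ℕ
  n = r * c
  R = 2 * r

  private
    open Chart chart
    open Insertion 0<r sP sQ chart using (crossing)
    module PR = Cells sP

    R≡ : R ≡ r + r
    R≡ = cong (r +_) (+-identityʳ r)
    r<R : r < R
    r<R = subst (r <_) (sym R≡) (subst (_< r + r) (+-identityʳ r) (+-monoʳ-< r 0<r))

  word : ℕ → ℕ → ℕ
  word = slides r y

  -- The column heights of the rotated complement of the shape of the first i entries of P; by inside-shape and
  -- outside-shape these are the column heights of the shape that the other entries of P form after i promotions.
  height : ℕ → ℕ → ℕ
  height i b = r ∸ cnt z i (c ∸ suc b)

  word-letter : ∀ i t → i + t < n → word i t < r
  word-letter zero t lt = row< t lt
  word-letter (suc i) t lt = slideWord-letter r (word i) t (λ s s≤ → word-letter i s (≤-trans (s≤s (≤-trans (+-monoʳ-≤ i s≤) (≤-reflexive (+-suc i t)))) lt))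

  word-complement : ∀ i d → i + d ≡ n → ∀ a → a < r → cnt (word i) d a + cnt y i (r ∸ suc a) ≡ c
  word-complement i d e a a< = subst (λ q → cnt (slides q y i) d a + cnt y i (r ∸ suc a) ≡ c) (m+[n∸m]≡n a<)
    (complement rect d i e a (r ∸ suc a) (≤-reflexive (m+[n∸m]≡n a<)))

  word-cnt≤ : ∀ i d → i + d ≡ n → ∀ a → a < r → cnt (word i) d a ≤ c
  word-cnt≤ i d e a a< = m+n≤o⇒m≤o _ (≤-reflexive (word-complement i d e a a<))

  word-none : ∀ i d t → i + d ≡ n → t ≤ d → ∀ a → r ≤ a → cnt (word i) t a ≡ 0
  word-none i d t e t≤ a r≤a = cnt-none (word i) t (λ s s< → word-letter i s (<-≤-trans (+-monoʳ-< i (<-≤-trans s< t≤)) (≤-reflexive e))) r≤a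

  -- Row counts and column heights both express whether the rotated cell of P, in row r - 1 - a and
  -- column c - 1 - b, has an entry ≤ i.
  inside-shape : ∀ i d → i + d ≡ n → ∀ a b → a < r → b < c → b < cnt (word i) d a → a < height i b
  inside-shape i d e a b a< b< lt = m+n≤o⇒m≤o∸n (suc a) (≤-trans (+-monoʳ-≤ (suc a) cnt≤) (≤-reflexive (m+[n∸m]≡n a<)))
    where
    a′< : r ∸ suc a < r
    a′< = ∸-monoʳ-< (s≤s z≤n) a<
    b′< : c ∸ suc b < c
    b′< = ∸-monoʳ-< (s≤s z≤n) b<
    few : cnt y i (r ∸ suc a) ≤ c ∸ suc b
    few = m+n≤o⇒m≤o∸n _ (≤-trans (≤-reflexive (+-comm _ (suc b))) (≤-trans (+-monoˡ-≤ _ lt) (≤-reflexive (word-complement i d e a a<))))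
    cnt≤ : cnt z i (c ∸ suc b) ≤ r ∸ suc a
    cnt≤ = ≮⇒≥ λ lt′ → <⇒≱ (row-above i _ _ a′< b′< few) (col-below i _ _ a′< b′< lt′)

  outside-shape : ∀ i d → i + d ≡ n → ∀ a b → a < r → b < c → cnt (word i) d a ≤ b → height i b ≤ a
  outside-shape i d e a b a< b< le = ≤-trans (∸-monoʳ-≤ r cnt>) (≤-reflexive (m∸[m∸n]≡n (<⇒≤ a<)))
    where
    a′< : r ∸ suc a < r
    a′< = ∸-monoʳ-< (s≤s z≤n) a<
    b′< : c ∸ suc b < c
    b′< = ∸-monoʳ-< (s≤s z≤n) b<
    many : c ∸ suc b < cnt y i (r ∸ suc a)
    many = +-cancelˡ-≤ (cnt (word i) d a) _ _ (≤-trans (≤-trans (≤-reflexive (+-suc _ _)) (+-monoˡ-≤ (c ∸ suc b) (s≤s le)))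
      (≤-reflexive (trans (m+[n∸m]≡n b<) (sym (word-complement i d e a a<)))))
    cnt> : r ∸ a ≤ cnt z i (c ∸ suc b)
    cnt> = ≤-trans (≤-reflexive (+-∸-assoc 1 a<)) (≰⇒> λ le′ → <⇒≱ (col-above i _ _ a′< b′< le′) (row-below i _ _ a′< b′< many))

  -- The tableau after i promotions: the entries left of P, the entries of Q, and those that were added.
  record Inv (i : ℕ) (U : Tab) : Set where
    field
      first : ∀ t → i + t < n → U (word i t) (cnt (word i) t (word i t)) ≡ suc (i + t)
      second : ∀ a b → a < r → b < c → U (a + height i b) b ≡ Q a b + n
      rest : ∀ a b → a < R → b < c → r + height i b ≤ a → 2 * n < U a b
  open Inv

  Q-positive : ∀ {a b} → a < r → b < c → 1 ≤ Q a b
  Q-positive = Standard.positive sQ _ _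

  -- Such a cell belongs to a letter s ≥ t of the word, to Q with its shift by n, or to the added
  -- entries.
  inv-large : ∀ i d {U} → i + d ≡ n → Inv i U → ∀ t → t ≤ d → ∀ a b → a < R → b < c → cnt (word i) t a ≤ b → i + t < U a b
  inv-large i d {U} e inv t t≤ a b a< b< le with b <? cnt (word i) d a
  ... | yes lt with cnt-hit (word i) d lt
  ... | s , s< , refl , refl = subst (i + t <_) (sym (first inv s (<-≤-trans (+-monoʳ-< i s<) (≤-reflexive e)))) (s≤s (+-monoʳ-≤ i (≮⇒≥ λ s<t → <⇒≱ (cnt-< (word i) s<t) le)))
  inv-large i d {U} e inv t t≤ a b a< b< le | no nlt with r + height i b ≤? a
  ... | yes big = ≤-<-trans (≤-trans (+-monoʳ-≤ i t≤) (≤-trans (≤-reflexive e) (m≤m+n n _))) (rest inv a b a< b< big)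
  ... | no nbig = subst (λ x → i + t < U x b) (m∸n+n≡m ht≤) (subst (i + t <_) (sym (second inv (a ∸ height i b) b small b<))
          (≤-<-trans (≤-trans (+-monoʳ-≤ i t≤) (≤-reflexive e)) (m<n+m n (Q-positive small b<))))
    where
    ht≤ : height i b ≤ a
    ht≤ with a <? r
    ... | yes a<r = outside-shape i d e a b a<r b< (≮⇒≥ nlt)
    ... | no a≮r = ≤-trans (m∸n≤m r (cnt z i (c ∸ suc b))) (≮⇒≥ a≮r)
    small : a ∸ height i b < r
    small = +-cancelʳ-< (height i b) _ _ (subst (_< r + height i b) (sym (m∸n+n≡m ht≤)) (≰⇒> nbig))

  module Stage (i L : ℕ) (e : i + suc L ≡ n) (U₀ : Tab) (inv : Inv i U₀) where
    private
      w w′ hl : ℕ → ℕ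
      w = word i
      w′ = word (suc i)
      hl = hole r w
      X : ℕ → ℕ → ℕ
      X = cnt w′

      e′ : suc i + L ≡ n
      e′ = trans (sym (+-suc i L)) e
      i<n : i < n
      i<n = ≤-trans (s≤s (m≤m+n i L)) (≤-reflexive e′)

      letter : ∀ s → s ≤ L → w s < r
      letter s s≤ = word-letter i s (≤-trans (s≤s (+-monoʳ-≤ i s≤)) (≤-reflexive e′))

      hl< : ∀ t → t ≤ L → hl t < r
      hl< t t≤ = hole-letter r w t (λ s s≤ → letter s (≤-trans s≤ t≤))

      count : ∀ t k → cnt w (suc t) k ≡ inc (hl t) (X t) k
      count = cnt-slide r w

      count² : ∀ t k → cnt w (suc (suc t)) k ≡ inc (w (suc t)) (inc (hl t) (X t)) k
      count² t = inc-cong-≗ (w (suc t)) (count t)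

      count-hole : ∀ t → cnt w (suc t) (hl t) ≡ suc (X t (hl t))
      count-hole t = trans (count t (hl t)) (inc-same (hl t) (X t))

      hole-col< : ∀ t → t ≤ L → X t (hl t) < c
      hole-col< t t≤ = ≤-trans (≤-reflexive (sym (count-hole t)))
        (≤-trans (cnt-mono w (hl t) (s≤s t≤)) (word-cnt≤ i (suc L) e (hl t) (hl< t t≤)))

      w0≡0 : w 0 ≡ 0
      w0≡0 = at (w 0) refl
        where
        at : ∀ k → w 0 ≡ k → w 0 ≡ 0
        at zero e = e
        at (suc k) eq = ⊥-elim (<⇒≱ (≤-reflexive (sym one)) (≤-trans (slides-decreasing rect r ≤-refl i 1 k (subst (_< r) eq (letter 0 z≤n))) (≤-reflexive none)))
          where
          none : cnt w 1 k ≡ 0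
          none = inc-other (λ _ → 0) (λ k≡ → 1+n≢n (trans (sym eq) (sym k≡)))
          one : cnt w 1 (suc k) ≡ 1
          one = trans (cong (cnt w 1) (sym eq)) (inc-same (w 0) (λ _ → 0))

    -- The filling in the middle of a slide. Among the cells of the rectangle, only that of the hole
    -- is left undescribed: by `cnt-slide` it is the difference of the two shapes.
    record State (t : ℕ) (U : Tab) : Set where
      field
        placed : ∀ s → s < t → U (w′ s) (X s (w′ s)) ≡ suc (suc i + s)
        fresh : ∀ a b → cnt w (suc t) a ≤ b → U a b ≡ U₀ a b
    open State

    private
      advance-state : ∀ t f U → t < L → Fuel {R} {c} f (hl t) (X t (hl t)) → State t U →
        Advanced {R} {c} {r} (hl t) (X t (hl t)) (hl (suc t)) (X (suc t) (hl (suc t))) (w′ t) (X t (w′ t)) (suc (i + suc t)) U (slide R c f U (hl t) (X t (hl t)))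
      advance-state t f U t<L fuel st = advance {f = f} r<R (hl< t (<⇒≤ t<L)) p<r q<
        (slides-decreasing rect r ≤-refl (suc i) t) (word-none (suc i) L t e′ (<⇒≤ t<L)) fuel (hole-col< t (<⇒≤ t<L))
        (trans (cong (U p) (sym (count t p))) (trans (fresh st p _ ≤-refl) (Inv.first inv (suc t) (≤-trans (s≤s (+-monoʳ-≤ i t<L)) (≤-reflexive e′)))))
        (λ a b a< b< le → subst₂ _<_ (+-suc i (suc t))
          (sym (fresh st a b (≤-trans (cnt-mono w a (n≤1+n (suc t))) (≤-trans (≤-reflexive (count² t a)) le))))
          (inv-large i (suc L) e inv (suc (suc t)) (s≤s t<L) a b a< b< (≤-trans (≤-reflexive (count² t a)) le)))
        (local-slide r w t)
        where
        p = w (suc t)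
        p<r : p < r
        p<r = letter (suc t) t<L
        q< : inc (hl t) (X t) p < c
        q< = <-≤-trans (subst (_< cnt w (suc (suc t)) p) (count t p) (cnt-< w {suc t} ≤-refl))
          (≤-trans (cnt-mono w p (s≤s t<L)) (word-cnt≤ i (suc L) e p p<r))

      next-state : ∀ t U U′ → State t U → U′ (w′ t) (X t (w′ t)) ≡ suc (i + suc t) →
        (∀ a b → NotAt {R} {c} (hl t) (X t (hl t)) a b → U′ a b ≡ U a b) → State (suc t) U′
      next-state t U U′ st moved unch = record { placed = placed′ ; fresh = fresh′ }
        where
        placed′ : ∀ s → s < suc t → U′ (w′ s) (X s (w′ s)) ≡ suc (suc i + s)
        placed′ s (s≤s s≤t) with m≤n⇒m<n∨m≡n s≤t
        ... | inj₂ refl = trans moved (cong suc (+-suc i t))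
        ... | inj₁ s<t = trans (unch _ _ (λ { (a≡ , b≡) → <⇒≢ (subst (λ k → X s k < X t k) a≡ (cnt-< w′ s<t)) (trans (cong (X s) (sym a≡)) b≡) })) (placed st s s<t)
        fresh′ : ∀ a b → cnt w (suc (suc t)) a ≤ b → U′ a b ≡ U₀ a b
        fresh′ a b le = trans (unch a b (λ { (refl , refl) → <⇒≱ (≤-trans (≤-reflexive (sym (count-hole t))) (cnt-mono w (hl t) (n≤1+n (suc t)))) le }))
          (fresh st a b (≤-trans (cnt-mono w a (n≤1+n (suc t))) le))

    record Arrived (res : Tab × List (ℕ × ℕ)) : Set where
      field
        fuel : ℕ
        tab : Tab
        fuel-ok : Fuel {R} {c} fuel (hl L) (X L (hl L))
        state : State L tab
        result : proj₁ res ≡ proj₁ (slide R c fuel tab (hl L) (X L (hl L)))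
        picks : ∀ k → r ≤ suc k → pick k (proj₂ res) ≡ pick k (proj₂ (slide R c fuel tab (hl L) (X L (hl L))))

    arrive : ∀ d t → t + d ≡ L → ∀ f U → Fuel {R} {c} f (hl t) (X t (hl t)) → State t U → Arrived (slide R c f U (hl t) (X t (hl t)))
    arrive zero t t≡ f U fuel st with trans (sym (+-identityʳ t)) t≡
    ... | refl = record { fuel = f ; tab = U ; fuel-ok = fuel ; state = st ; result = refl ; picks = λ _ _ → refl }
    arrive (suc d) t t≡ f U fuel st = record
      { fuel = B.fuel ; tab = B.tab ; fuel-ok = B.fuel-ok ; state = B.state
      ; result = trans A.result B.result ; picks = λ k r≤ → trans (A.picks k r≤) (B.picks k r≤) }
      where
      t<L : t < L
      t<L = ≤-trans (s≤s (m≤m+n t d)) (≤-reflexive (trans (sym (+-suc t d)) t≡))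
      module A = Advanced (advance-state t f U t<L fuel st)
      arrived : Arrived (slide R c A.fuel A.tab (hl (suc t)) (X (suc t) (hl (suc t))))
      arrived = arrive d (suc t) (trans (sym (+-suc t d)) t≡) A.fuel A.tab A.fuel-ok (next-state t U A.tab st A.moved A.unchanged)
      module B = Arrived arrived

    private
      -- the row and column in which the hole leaves the entries of P
      x b : ℕ
      x = hl L
      b = c ∸ suc (z i)

      y< : y i < r
      y< = row< i i<n
      z< : z i < c
      z< = Chart.col< chart i i<n

      x≡ : x ≡ r ∸ suc (y i)
      x≡ = subst (λ q → hole q (slides q y i) L ≡ r ∸ suc (y i)) full≡
        (hole-complement rect i L (complement rect L (suc i) e′) (r ∸ suc (y i)) (≤-reflexive full≡))
        where
        full≡ : suc (r ∸ suc (y i) + y i) ≡ r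
        full≡ = trans (sym (+-suc _ (y i))) (m∸n+n≡m y<)

      x< : x < r
      x< = hl< L ≤-refl

      X≡ : X L x ≡ b
      X≡ = trans (sym (m+n∸n≡m (X L x) (suc (z i)))) (cong (_∸ suc (z i)) (begin
        X L x + suc (z i) ≡⟨ cong (X L x +_) (cong suc (row-count i i<n)) ⟨
        X L x + suc (cnt y i (y i)) ≡⟨ cong (X L x +_) (inc-same (y i) (cnt y i)) ⟨
        X L x + cnt y (suc i) (y i) ≡⟨ cong (λ k → X L x + cnt y (suc i) k) (trans (cong (λ k → r ∸ suc k) x≡) (∸-involutive y<)) ⟨
        X L x + cnt y (suc i) (r ∸ suc x) ≡⟨ word-complement (suc i) L e′ x x< ⟩
        c ∎))
        where open ≡-Reasoning

      b< : b < c
      b< = ∸-monoʳ-< (s≤s z≤n) z<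

      height-b : height i b ≡ suc x
      height-b = begin
        r ∸ cnt z i (c ∸ suc b) ≡⟨ cong (λ k → r ∸ cnt z i k) (∸-involutive z<) ⟩
        r ∸ cnt z i (z i) ≡⟨ cong (r ∸_) (col-count i i<n) ⟩
        r ∸ y i ≡⟨ +-∸-assoc 1 y< ⟩
        suc (r ∸ suc (y i)) ≡⟨ cong suc x≡ ⟨
        suc x ∎
        where open ≡-Reasoning

      height′-b : height (suc i) b ≡ x
      height′-b = begin
        r ∸ cnt z (suc i) (c ∸ suc b) ≡⟨ cong (λ k → r ∸ cnt z (suc i) k) (∸-involutive z<) ⟩
        r ∸ cnt z (suc i) (z i) ≡⟨ cong (r ∸_) (trans (inc-same (z i) (cnt z i)) (cong suc (col-count i i<n))) ⟩
        r ∸ suc (y i) ≡⟨ x≡ ⟨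
        x ∎
        where open ≡-Reasoning

      height′-other : ∀ {j} → j < c → j ≢ b → height (suc i) j ≡ height i j
      height′-other {j} j< j≢ = cong (r ∸_) (inc-other (cnt z i) (λ eq → j≢ (trans (sym (∸-involutive j<)) (cong (λ k → c ∸ suc k) eq))))

      -- These columns correspond to the columns of P left of `z i`, whose entries in row `y i` are
      -- already ≤ i.
      height-right : ∀ {j} → b < j → j < c → height i j ≤ x
      height-right {j} b<j j< = ≤-trans (∸-monoʳ-≤ r long) (≤-reflexive (sym x≡))
        where
        k = c ∸ suc j
        k<z : k < z i
        k<z = subst (k <_) (∸-involutive z<) (∸-monoʳ-< (s≤s b<j) j<)
        long : y i < cnt z i k
        long = ≰⇒> λ le → <⇒≱ (col-above i (y i) k y< (<-trans k<z z<) le)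
          (s≤s⁻¹ (subst (P (y i) k <_) (entry i i<n) (PR.row-strict y< k<z z<)))

      untouched : ∀ {U} → State L U → ∀ a j → j < c → height i j ≤ a → U a j ≡ U₀ a j
      untouched st a j j< ht≤ = fresh st a j (out (a <? r))
        where
        out : Dec (a < r) → cnt w (suc L) a ≤ j
        out (yes a<r) = ≮⇒≥ λ lt → <⇒≱ (inside-shape i (suc L) e a j a<r j< lt) ht≤
        out (no a≮r) = ≤-trans (≤-reflexive (word-none i (suc L) (suc L) e ≤-refl a (≮⇒≥ a≮r))) z≤n

      in-second : ∀ a j → a < r → j < c → U₀ (a + height i j) j ≡ Q a j + n
      in-second = Inv.second inv

      Q≤n : ∀ {a j} → a < r → j < c → Q a j ≤ n
      Q≤n = Standard.bounded sQ _ _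

      2n≡ : 2 * n ≡ n + n
      2n≡ = cong (n +_) (+-identityʳ n)

      below≡ : ∀ a → a < r → U₀ (suc (x + a)) b ≡ Q a b + n
      below≡ a a<r = trans (cong (λ k → U₀ k b) (trans (+-comm (suc x) a) (cong (a +_) (sym height-b)))) (in-second a b a<r b<)

      -- Why the hole falls straight: column b + 1 of Q has already risen above the level of the
      -- hole, so the right neighbour comes from row a of Q or a lower one, one column further
      -- right, or it is an added entry.
      column-first : ∀ a → a < r → suc b < c → U₀ (suc (x + a)) b < U₀ (x + a) (suc b)
      column-first a a<r sb< = subst (_< U₀ (x + a) (suc b)) (sym (below≡ a a<r)) (beside (r + height i (suc b) ≤? x + a))
        where
        ht≤ : height i (suc b) ≤ x
        ht≤ = height-right ≤-refl sb<
        xa< : x + a < R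
        xa< = subst (x + a <_) (sym R≡) (+-mono-< x< a<r)
        beside : Dec (r + height i (suc b) ≤ x + a) → Q a b + n < U₀ (x + a) (suc b)
        beside (yes big) = ≤-<-trans (≤-trans (+-monoˡ-≤ n (Q≤n a<r b<)) (≤-reflexive (sym 2n≡))) (Inv.rest inv (x + a) (suc b) xa< sb< big)
        beside (no nbig) = subst (Q a b + n <_) (sym (trans (cong (λ k → U₀ k (suc b)) (sym row≡)) (in-second a″ (suc b) a″<r sb<)))
          (+-monoˡ-< n (<-≤-trans (Standard.row-step sQ a b a<r sb<) (standard-mono sQ a≤a″ ≤-refl a″<r sb<)))
          where
          a″ = x + a ∸ height i (suc b)
          row≡ : a″ + height i (suc b) ≡ x + a
          row≡ = m∸n+n≡m (≤-trans ht≤ (m≤m+n x a))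
          a″<r : a″ < r
          a″<r = +-cancelʳ-< (height i (suc b)) _ _ (subst (_< r + height i (suc b)) (sym row≡) (≰⇒> nbig))
          a≤a″ : a ≤ a″
          a≤a″ = m+n≤o⇒m≤o∸n a (≤-trans (≤-reflexive (+-comm a _)) (+-monoˡ-≤ a ht≤))

      least : argmin R c U₀ ≡ (0 , 0)
      least = argmin-origin R c U₀ (<-trans 0<r r<R) 0<c λ a j a< j< ne →
        subst (_< U₀ a j) (sym origin) (subst (_< U₀ a j) (+-comm i 1)
          (inv-large i (suc L) e inv 1 (s≤s z≤n) a j a< j< (cnt₁ a j ne)))
        where
        cnt₁ : ∀ a j → ¬ (a ≡ 0 × j ≡ 0) → cnt w 1 a ≤ j
        cnt₁ a zero ne = ≤-reflexive (inc-other (λ _ → 0) (λ a≡ → ne (trans a≡ w0≡0 , refl)))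
        cnt₁ a (suc j) ne with a ≟ w 0
        ... | yes _ = s≤s z≤n
        ... | no _ = z≤n
        origin : U₀ 0 0 ≡ suc i
        origin = trans (cong (λ k → U₀ k 0) (sym w0≡0)) (trans (Inv.first inv 0 (subst (_< n) (sym (+-identityʳ i)) i<n)) (cong suc (+-identityʳ i)))

      origin-positive : 1 ≤ U₀ 0 0
      origin-positive = ≤-trans (s≤s z≤n) (inv-large i (suc L) e inv 0 z≤n 0 0 (<-trans 0<r r<R) 0<c z≤n)

      slid : Tab × List (ℕ × ℕ)
      slid = slide R c (R + c) U₀ 0 0

      gro-slid : gro R c U₀ ≡ (upd (proj₁ slid) (R ∸ 1) (c ∸ 1) (U₀ 0 0 + R * c) , proj₂ slid)
      gro-slid rewrite least = refl

      start : State 0 U₀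
      start = record { placed = λ _ () ; fresh = λ _ _ _ → refl }

      arrived : Arrived slid
      arrived = subst (λ k → Arrived (slide R c (R + c) U₀ k 0)) w0≡0
        (arrive L 0 refl (R + c) U₀ (trans (cong (λ k → R + c + (k + 0)) w0≡0) (+-identityʳ (R + c))) start)

      module A = Arrived arrived

      x+r<R : x + r < R
      x+r<R = subst (x + r <_) (sym R≡) (+-monoˡ-< r x<)

      descended : Descent {R} {c} r A.tab x b (slide R c A.fuel A.tab x b)
      descended = descent {R} {c} r A.fuel A.tab x b (subst (Fuel {R} {c} A.fuel x) X≡ A.fuel-ok) x+r<R b<
        (λ a a<r sb< → subst₂ _<_
          (sym (untouched A.state (suc (x + a)) b b< (≤-trans (≤-reflexive height-b) (s≤s (m≤m+n x a)))))
          (sym (untouched A.state (x + a) (suc b) sb< (≤-trans (height-right ≤-refl sb<) (m≤m+n x a))))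
          (column-first a a<r sb<))

      module D = Descent descended

      slid≡ : proj₁ slid ≡ proj₁ (slide R c D.fuel D.tab (x + r) b)
      slid≡ = trans A.result (trans (cong (λ k → proj₁ (slide R c A.fuel A.tab x k)) X≡) D.continues)

      avoids-column : ∀ {a j} → ¬ (j ≡ b × x ≤ a × a < x + r) → D.tab a j ≡ A.tab a j
      avoids-column nc = D.unchanged _ _ nc

      tail : LargeTail {R} {c} (2 * n) (x + r) b D.tab (proj₁ slid)
      tail = subst (LargeTail {R} {c} (2 * n) (x + r) b D.tab) (sym slid≡)
        (slide-large (2 * n) D.fuel D.tab (x + r) b D.fuel-ok x+r<R b< big)
        where
        big : ∀ a j → a < R → j < c → SouthEast {R} {c} (x + r) b a j → NotAt {R} {c} (x + r) b a j → 2 * n < D.tab a j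
        big a j a< j< (xr≤a , b≤j) na = subst (2 * n <_)
          (sym (trans (avoids-column (λ { (_ , _ , a<) → <⇒≱ a< xr≤a })) (untouched A.state a j j< (≤-trans (m≤n+m _ r) deep))))
          (Inv.rest inv a j a< j< deep)
          where
          deep : r + height i j ≤ a
          deep with m≤n⇒m<n∨m≡n b≤j
          ... | inj₁ b<j = ≤-trans (+-monoʳ-≤ r (height-right b<j j<)) (≤-trans (≤-reflexive (+-comm r x)) xr≤a)
          ... | inj₂ refl = ≤-trans (≤-reflexive (trans (cong (r +_) height-b) (trans (+-suc r x) (cong suc (+-comm r x)))))
                  (≤∧≢⇒< xr≤a (λ eq → na (sym eq , refl)))

      final : Tab
      final = upd (proj₁ slid) (R ∸ 1) (c ∸ 1) (U₀ 0 0 + R * c)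

      final-outside : ∀ {a j} → ¬ SouthEast {R} {c} (x + r) b a j → final a j ≡ D.tab a j
      final-outside nse = trans (upd-other (proj₁ slid) (R ∸ 1) (c ∸ 1) _ (λ { (refl , refl) → nse (<⇒≤pred x+r<R , <⇒≤pred b<) }))
        (LargeTail.unchanged tail _ _ nse)

      final-inv : Inv (suc i) final
      final-inv = record { first = first′ ; second = second′ ; rest = rest′ }
        where
        first′ : ∀ t → suc i + t < n → final (w′ t) (X t (w′ t)) ≡ suc (suc i + t)
        first′ t lt = trans (final-outside (λ { (xr≤ , _) → <⇒≱ a<r (≤-trans (m≤n+m r x) xr≤) }))
          (trans (avoids-column λ { (j≡b , x≤a , _) → <⇒≱ (inside-shape (suc i) L e′ (w′ t) b a<r b< (subst (_< X L (w′ t)) j≡b (cnt-< w′ t<L)))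
                    (≤-trans (≤-reflexive height′-b) x≤a) })
            (State.placed A.state t t<L))
          where
          t<L : t < L
          t<L = +-cancelˡ-< (suc i) _ _ (<-≤-trans lt (≤-reflexive (sym e′)))
          a<r : w′ t < r
          a<r = word-letter (suc i) t lt
        second′ : ∀ a j → a < r → j < c → final (a + height (suc i) j) j ≡ Q a j + n
        second′ a j a<r j< with j ≟ b
        ... | yes refl = trans (cong (λ k → final k b) (trans (cong (a +_) height′-b) (+-comm a x)))
          (trans (final-outside (λ { (xr≤ , _) → <⇒≱ (+-monoʳ-< x a<r) xr≤ }))
            (trans (D.shifted a a<r) (trans (untouched A.state (suc (x + a)) b b< (≤-trans (≤-reflexive height-b) (s≤s (m≤m+n x a)))) (below≡ a a<r))))
        ... | no j≢b = trans (cong (λ k → final (a + k) j) (height′-other j< j≢b))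
          (trans (final-outside nse) (trans (avoids-column (λ { (j≡b , _) → j≢b j≡b })) (trans (untouched A.state (a + height i j) j j< (m≤n+m _ a)) (in-second a j a<r j<))))
          where
          nse : ¬ SouthEast {R} {c} (x + r) b (a + height i j) j
          nse (xr≤ , b≤j) = <⇒≱ (<-≤-trans (+-monoˡ-< (height i j) a<r) (≤-trans (+-monoʳ-≤ r (height-right (≤∧≢⇒< b≤j (λ eq → j≢b (sym eq))) j<)) (≤-reflexive (+-comm r x)))) xr≤
        rest′ : ∀ a j → a < R → j < c → r + height (suc i) j ≤ a → 2 * n < final a j
        rest′ a j a< j< deep with (x + r ≤? a) ×-dec (b ≤? j)
        ... | no nse = subst (2 * n <_)
                (sym (trans (final-outside nse) (trans (avoids-column (λ { (j≡b , _) → j≢b j≡b })) (untouched A.state a j j< (≤-trans (≤-reflexive (sym same-height)) (≤-trans (m≤n+m _ r) deep))))))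
                (Inv.rest inv a j a< j< (subst (λ k → r + k ≤ a) same-height deep))
          where
          j≢b : j ≢ b
          j≢b refl = nse (≤-trans (≤-reflexive (trans (+-comm x r) (cong (r +_) (sym height′-b)))) deep , ≤-refl)
          same-height : height (suc i) j ≡ height i j
          same-height = height′-other j< j≢b
        ... | yes se with (a ≟ R ∸ 1) ×-dec (j ≟ c ∸ 1)
        -- The new corner entry is at least 1 + 2n, which is what `rest` asks of added entries.
        ... | yes (refl , refl) = subst (2 * n <_) (sym (upd-same (proj₁ slid) (R ∸ 1) (c ∸ 1) _)) (+-mono-≤ origin-positive (≤-reflexive (sym (*-assoc 2 r c))))
        ... | no nc = subst (2 * n <_) (sym (upd-other (proj₁ slid) (R ∸ 1) (c ∸ 1) _ nc)) (LargeTail.large tail a j a< j< se nc)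

      -- The hole starts to fall in row x = r - 1 - `y i`, so the move into row r - 1 is the one
      -- with number `y i`, counted from 0, and lifts the entry in row `y i` of Q.
      crosses : pick (r ∸ 1) (proj₂ slid) ≡ crossing i + n
      crosses = begin
        pick (r ∸ 1) (proj₂ slid) ≡⟨ A.picks (r ∸ 1) (≤-reflexive (sym (m+[n∸m]≡n 0<r))) ⟩
        pick (r ∸ 1) (proj₂ (slide R c A.fuel A.tab x (X L x))) ≡⟨ cong₂ (λ k l → pick k (proj₂ (slide R c A.fuel A.tab x l))) row≡ X≡ ⟩
        pick (x + y i) (proj₂ (slide R c A.fuel A.tab x b)) ≡⟨ D.moves (y i) y< ⟩
        A.tab (suc (x + y i)) b ≡⟨ untouched A.state (suc (x + y i)) b b< (≤-trans (≤-reflexive height-b) (s≤s (m≤m+n x (y i)))) ⟩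
        U₀ (suc (x + y i)) b ≡⟨ below≡ (y i) y< ⟩
        crossing i + n ∎
        where
        open ≡-Reasoning
        row≡ : r ∸ 1 ≡ x + y i
        row≡ = sym (trans (cong (_+ y i) x≡) (suc-injective (trans (sym (+-suc _ (y i))) (trans (m∸n+n≡m y<) (sym (m+[n∸m]≡n 0<r))))))

    stage : Inv (suc i) (proj₁ (gro R c U₀)) × pick (r ∸ 1) (proj₂ (gro R c U₀)) ≡ crossing i + n
    stage = subst (λ res → Inv (suc i) (proj₁ res) × pick (r ∸ 1) (proj₂ res) ≡ crossing i + n) (sym gro-slid) (final-inv , crosses)

-- The promotion permutation of the stack

module _ {r c : ℕ} {P Q : Tab} (0<r : 0 < r) (0<c : 0 < c) (sytP : IsSYT r c P) (sytQ : IsSYT r c Q) where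

  private
    sP = syt-standard sytP
    sQ = syt-standard sytQ
    chart = standard-chart sP
    open Chart chart
    open Insertion 0<r sP sQ chart using (crossing; RS-crossing)
    open Growth 0<r 0<c sP sQ chart (syt-word sytP)

    size : R * c ≡ n + n
    size = trans (*-assoc 2 r c) (cong (n +_) (+-identityʳ n))

  stack-inv : Inv 0 (stack r n P Q)
  stack-inv = record { first = first ; second = second ; rest = rest }
    where
    y = Cells.rowOf sP
    first : ∀ t → t < n → stack r n P Q (y t) (cnt y t (y t)) ≡ suc t
    first t t<n rewrite <ᵇ-true (row< t t<n) | row-count t t<n = entry t t<n
    second : ∀ a b → a < r → b < c → stack r n P Q (a + r) b ≡ Q a b + n
    second a b _ _ rewrite <ᵇ-false (m≤n+m r a) | m+n∸n≡m a r = refl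
    rest : ∀ a b → a < R → b < c → r + r ≤ a → 2 * n < stack r n P Q a b
    rest a b a< _ r+r≤a = ⊥-elim (<⇒≱ a< (≤-trans (≤-reflexive (cong (r +_) (+-identityʳ r))) r+r≤a))

  residue-small : ∀ N v → 1 ≤ v → v ≤ N → residue N v ≡ v
  residue-small (suc k) (suc v) _ (s≤s v≤k) = cong suc (m≤n⇒m%n≡m v≤k)
  residue-small zero (suc v) _ ()

  -- The invariant covers the n promotions that use up P; k counts the later ones. T₀ is the
  -- argument of the enclosing `prom` and stays fixed while T advances.
  take-promGo : ∀ d k i T₀ T → i + d ≡ n → Inv i T →
    take d (promGo r R c T₀ (d + k) T) ≡ applyUpTo (λ s → crossing (i + s) + n) d
  take-promGo zero k i T₀ T e inv = refl
  take-promGo (suc d) k i T₀ T e inv = cong₂ _∷_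
    (trans (cong (residue (R * c)) (proj₂ next-stage))
      -- Here 1 ≤ `crossing i + n` ≤ 2n = `R * c`, so the reduction changes nothing.
      (trans (residue-small (R * c) (crossing i + n) (≤-trans positive (m≤m+n _ n))
        (≤-trans (+-monoˡ-≤ n bounded) (≤-reflexive (sym size))))
        (cong (λ k → crossing k + n) (sym (+-identityʳ i)))))
    (trans (take-promGo d k (suc i) T₀ _ (trans (sym (+-suc i d)) e) (proj₁ next-stage))
      (applyUpTo-cong d (λ s _ → cong (λ k → crossing k + n) (sym (+-suc i s)))))
    where
    next-stage = Stage.stage i d e T inv
    i<n : i < n
    i<n = ≤-trans (s≤s (m≤m+n i d)) (≤-reflexive (trans (sym (+-suc i d)) e))
    flipped< : c ∸ suc (Cells.colOf sP i) < c
    flipped< = ∸-monoʳ-< (s≤s z≤n) (col< i i<n)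
    positive : 1 ≤ crossing i
    positive = Standard.positive sQ _ _ (row< i i<n) flipped<
    bounded : crossing i ≤ n
    bounded = Standard.bounded sQ _ _ (row< i i<n) flipped<

  prom-crossing : map (λ v → v ∸ n) (take n (prom r R c (stack r n P Q))) ≡ applyUpTo crossing n
  prom-crossing = begin
    map (λ v → v ∸ n) (take n (prom r R c S)) ≡⟨ cong (λ N → map (λ v → v ∸ n) (take n (promGo r R c S N S))) size ⟩
    map (λ v → v ∸ n) (take n (promGo r R c S (n + n) S)) ≡⟨ cong (map (λ v → v ∸ n)) (take-promGo n n 0 S S refl stack-inv) ⟩
    map (λ v → v ∸ n) (applyUpTo (λ s → crossing s + n) n) ≡⟨ map-applyUpTo (λ s → crossing s + n) (λ v → v ∸ n) n ⟩
    applyUpTo (λ s → crossing s + n ∸ n) n ≡⟨ applyUpTo-cong n (λ s _ → m+n∸n≡m (crossing s) n) ⟩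
    applyUpTo crossing n ∎
    where
    open ≡-Reasoning
    S = stack r n P Q

theorem1p1 : (r c : ℕ) → 1 ≤ r → 1 ≤ c → (P Q : Tab) → IsSYT r c P → IsSYT r c Q →
    (map (λ v → v ∸ (r * c)) (take (r * c) (prom r (2 * r) c (stack r (r * c) P Q))) ↭ oneTo (r * c))
    × (RS (map (λ v → v ∸ (r * c)) (take (r * c) (prom r (2 * r) c (stack r (r * c) P Q))))
       ≡ (transposeRows r c Q , transposeRows r c P))
theorem1p1 r c 0<r 0<c P Q sytP sytQ =
  subst (_↭ oneTo (r * c)) (sym word≡) (crossing-↭ 0<r sytP sytQ) ,
  trans (cong RS word≡) (Insertion.RS-crossing 0<r (syt-standard sytP) (syt-standard sytQ) (standard-chart (syt-standard sytP)))
  where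
  word≡ = prom-crossing 0<r 0<c sytP sytQ
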